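{- For each $n\geq 2$ let $\delta$ be a uniformly random transition function of an automaton with state set $[n]$ and alphabet $\{a,b\}$, and let $\omega$ be the word $$\omega:=a^{\lceil \sqrt{n}\rceil}\,\bigl(b\,a^{\lceil \sqrt{n}\rceil}\bigr)^{\lceil \sqrt{\log_2 n}\rceil}.$$ Let $A:=\delta_\omega([n])$ be the set of states that can be reached by inputting $\omega$. Then $\mathbb{E}[|A|]=O(\sqrt{n/\log n})$ as $n\to\infty$.
   Context: $[n]=\{1,\dots,n\}$. A random automaton on state set $[n]$ with alphabet $\{a,b\}$ is given by a transition function $\delta:[n]\times\{a,b\}\to[n]$ chosen uniformly among all $n^{2n}$ such functions; equivalently, the values $\delta_c(x):=\delta(x,c)$, for $x\in[n]$, $c\in\{a,b\}$, are independent and uniform on $[n]$. For a word $\omega=\omega_1\omega_2\cdots\omega_m\in\{a,b\}^*$ put $\delta_\omega:=\delta_{\omega_m}\circ\cdots\circ\delta_{\omega_1}$ (letters are read from left to right), and for $B\subseteq[n]$ put $\delta_\omega(B):=\{\delta_\omega(x):x\in B\}$. For a word $u$ and an integer $m\ge 0$, $u^m$ is $u$ repeated $m$ times. -}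

module Defs where

open import Data.Empty using (⊥; ⊥-elim)
open import Data.Fin using (Fin; zero; suc; combine; quotient; remainder; remQuot; finToFun; funToFin)
open import Data.Fin.Properties
  using (any?; finToFun-funToFin; funToFin-finToFin; remQuot-combine; combine-remQuot)
  renaming (_≟_ to _≟ᶠ_)
open import Data.Fin.Subset using (Subset; ∣_∣; ⊤)
open import Data.Fin.Subset.Properties using (_∈?_)
open import Data.Integer as ℤ using (+_; -[1+_])
import Data.Integer.Properties as ℤ
open import Data.List using (List; []; _∷_; _++_; foldl; concat; replicate)
open import Data.Nat as ℕ using (ℕ; zero; suc; NonZero; NonTrivial)
open import Data.Nat.Coprimality using (Coprime)
import Data.Nat.Properties as ℕ
open import Algebra.Properties.Semiring.Sum ℕ.+-*-semiring using (sum)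
open import Data.Product using (Σ; ∃; ∃-syntax; Σ-syntax; _×_; _,_; proj₁; proj₂)
open import Data.Rational hiding (truncate; floor; ceiling; round; ∣_∣; NonZero)
open import Data.Rational.Properties
import Data.Rational.Unnormalised as ℚᵘ
import Data.Rational.Unnormalised.Properties as ℚᵘ
open import Data.Rational.Solver using (module +-*-Solver)
open import Data.Sum using (_⊎_; inj₁; inj₂; [_,_])
open import Data.Unit using (tt) renaming (⊤ to Unit)
open import Data.Vec using (tabulate)
open import Relation.Binary.Definitions using (tri<; tri≈; tri>)
open import Relation.Binary.PropositionalEquality
  using (_≡_; refl; sym; trans; cong; cong₂; subst; subst₂)
open import Relation.Nullary using (¬_; Dec; yes; no; does)
open import Relation.Nullary.Decidable using (_×-dec_; _⊎-dec_)
open +-*-Solver using (solve; _:+_; _:*_; _:-_; con; _:=_)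

-- Dedekind reals: `lower q` is q < x, `upper q` is x < q.

record ℝ : Set₁ where
  field
    lower upper     : ℚ → Set
    lower-inhabited : ∃ lower
    upper-inhabited : ∃ upper
    lower-down      : ∀ {q r} → q < r → lower r → lower q
    upper-up        : ∀ {q r} → q < r → upper q → upper r
    lower-open      : ∀ {q} → lower q → ∃[ r ] q < r × lower r
    upper-open      : ∀ {q} → upper q → ∃[ r ] r < q × upper r
    disjoint        : ∀ {q} → lower q → upper q → ⊥
    located         : ∀ {q r} → q < r → lower q ⊎ upper r

open ℝ

infix 4 _≤ᵣ_ _<ᵣ_

_≤ᵣ_ : ℝ → ℝ → Set
x ≤ᵣ y = ∀ q → lower x q → lower y q

_<ᵣ_ : ℝ → ℝ → Set
x <ᵣ y = ∃[ q ] upper x q × lower y q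

private

  0<1 : 0ℚ < 1ℚ
  0<1 = positive⁻¹ 1ℚ

  -1<0 : - 1ℚ < 0ℚ
  -1<0 = negative⁻¹ (- 1ℚ)

  ≮0⇒0≤ : ∀ {p} → ¬ p < 0ℚ → 0ℚ ≤ p
  ≮0⇒0≤ = ≮⇒≥

  p≤p+q : ∀ p {q} → 0ℚ ≤ q → p ≤ p + q
  p≤p+q p 0≤q = subst (_≤ p + _) (+-identityʳ p) (+-monoʳ-≤ p 0≤q)

  p<p+1 : ∀ p → p < p + 1ℚ
  p<p+1 p = subst (_< p + 1ℚ) (+-identityʳ p) (+-monoʳ-< p 0<1)

  p-1<p : ∀ p → p - 1ℚ < p
  p-1<p p = subst (p - 1ℚ <_) (+-identityʳ p) (+-monoʳ-< p -1<0)

  monoˡ-< : ∀ {z p q} → 0ℚ < z → p < q → p * z < q * z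
  monoˡ-< {z} 0<z = *-monoˡ-<-pos z {{positive 0<z}}

  monoʳ-< : ∀ {z p q} → 0ℚ < z → p < q → z * p < z * q
  monoʳ-< {z} 0<z = *-monoʳ-<-pos z {{positive 0<z}}

  cancelʳ-< : ∀ {z p q} → 0ℚ < z → p * z < q * z → p < q
  cancelʳ-< {z} 0<z = *-cancelʳ-<-nonNeg z {{nonNegative (<⇒≤ 0<z)}}

  cancelʳ-≤ : ∀ {z p q} → 0ℚ < z → p * z ≤ q * z → p ≤ q
  cancelʳ-≤ {z} 0<z = *-cancelʳ-≤-pos z {{positive 0<z}}

  *-pos : ∀ {p q} → 0ℚ < p → 0ℚ < q → 0ℚ < p * q
  *-pos {p} {q} 0<p 0<q = subst (_< p * q) (*-zeroˡ q) (monoˡ-< 0<q 0<p)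

  *-nonNeg : ∀ {p q} → 0ℚ ≤ p → 0ℚ ≤ q → 0ℚ ≤ p * q
  *-nonNeg {p} {q} 0≤p 0≤q =
    subst (_≤ p * q) (*-zeroˡ q) (*-monoʳ-≤-nonNeg q {{nonNegative 0≤q}} 0≤p)

  sq-mono-< : ∀ {q r} → 0ℚ ≤ q → q < r → q * q < r * r
  sq-mono-< {q} {r} 0≤q q<r = ≤-<-trans
    (*-monoˡ-≤-nonNeg q {{nonNegative 0≤q}} (<⇒≤ q<r))
    (monoˡ-< (≤-<-trans 0≤q q<r) q<r)

  sub-nonNeg : ∀ {p q} → p ≤ q → 0ℚ ≤ q - p
  sub-nonNeg {p} {q} p≤q = subst (_≤ q - p) (+-inverseʳ p) (+-monoˡ-≤ (- p) p≤q)

  quot : ∀ p {z} → 0ℚ < z → ∃[ r ] r * z ≡ p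
  quot p {z} 0<z = p * 1/ z , trans (*-assoc p (1/ z) z)
    (trans (cong (p *_) (*-inverseˡ z)) (*-identityʳ p))
    where instance _ = >-nonZero 0<z

  lower<upper : ∀ x {q r} → lower x q → upper x r → q < r
  lower<upper x {q} {r} l u with <-cmp q r
  ... | tri< q<r _ _    = q<r
  ... | tri≈ _ refl _   = ⊥-elim (disjoint x l u)
  ... | tri> _ _ r<q    = ⊥-elim (disjoint x (lower-down x r<q l) u)

  lower-down≤ : ∀ x {q r} → q ≤ r → lower x r → lower x q
  lower-down≤ x {q} {r} q≤r l with <-cmp q r
  ... | tri< q<r _ _    = lower-down x q<r l
  ... | tri≈ _ refl _   = l
  ... | tri> _ _ r<q    = ⊥-elim (<-irrefl refl (<-≤-trans r<q q≤r))

  upper-up≤ : ∀ x {q r} → q ≤ r → upper x q → upper x r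
  upper-up≤ x {q} {r} q≤r u with <-cmp q r
  ... | tri< q<r _ _    = upper-up x q<r u
  ... | tri≈ _ refl _   = u
  ... | tri> _ _ r<q    = ⊥-elim (<-irrefl refl (<-≤-trans r<q q≤r))

ofℚ : ℚ → ℝ
ofℚ p = record
  { lower           = _< p
  ; upper           = p <_
  ; lower-inhabited = p - 1ℚ , p-1<p p
  ; upper-inhabited = p + 1ℚ , p<p+1 p
  ; lower-down      = <-trans
  ; upper-up        = λ q<r p<q → <-trans p<q q<r
  ; lower-open      = λ q<p → let r , q<r , r<p = <-dense q<p in r , q<r , r<p
  ; upper-open      = λ p<q → let r , p<r , r<q = <-dense p<q in r , r<q , p<r
  ; disjoint        = <-asym
  ; located         = loc
  }
  where
  loc : ∀ {q r} → q < r → q < p ⊎ p < r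
  loc {q} q<r with q <? p
  ... | yes q<p = inj₁ q<p
  ... | no  q≮p = inj₂ (≤-<-trans (≮⇒≥ q≮p) q<r)

ofℕ : ℕ → ℝ
ofℕ n = ofℚ (+ n / 1)

infixr 7 _•_

_•_ : (c : ℚ) .{{_ : Positive c}} → ℝ → ℝ
c • x = record
  { lower           = λ q → lower x (q ÷ c)
  ; upper           = λ q → upper x (q ÷ c)
  ; lower-inhabited = let s , l = lower-inhabited x in s * c , subst (lower x) (sym (s*c÷c s)) l
  ; upper-inhabited = let s , u = upper-inhabited x in s * c , subst (upper x) (sym (s*c÷c s)) u
  ; lower-down      = λ q<r → lower-down x (÷-mono q<r)
  ; upper-up        = λ q<r → upper-up x (÷-mono q<r)
  ; lower-open      = λ {q} l → let s , q÷c<s , ls = lower-open x l in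
      s * c , subst (_< s * c) (q÷c*c q) (*-monoˡ-<-pos c q÷c<s)
            , subst (lower x) (sym (s*c÷c s)) ls
  ; upper-open      = λ {q} u → let s , s<q÷c , us = upper-open x u in
      s * c , subst (s * c <_) (q÷c*c q) (*-monoˡ-<-pos c s<q÷c)
            , subst (upper x) (sym (s*c÷c s)) us
  ; disjoint        = disjoint x
  ; located         = λ q<r → located x (÷-mono q<r)
  }
  where
  instance _ = pos⇒nonZero c
  ÷-mono : ∀ {q r} → q < r → q ÷ c < r ÷ c
  ÷-mono = *-monoˡ-<-pos (1/ c) {{1/pos⇒pos c}}
  s*c÷c : ∀ s → s * c ÷ c ≡ s
  s*c÷c s = trans (*-assoc s c (1/ c)) (trans (cong (s *_) (*-inverseʳ c)) (*-identityʳ s))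
  q÷c*c : ∀ q → q ÷ c * c ≡ q
  q÷c*c q = trans (*-assoc q (1/ c) c) (trans (cong (q *_) (*-inverseˡ c)) (*-identityʳ q))

reciprocal : (x : ℝ) → lower x 0ℚ → ℝ
reciprocal x 0<x = record
  { lower           = λ q → ∃[ r ] upper x r × q * r < 1ℚ
  ; upper           = λ q → ∃[ r ] lower x r × 0ℚ < r × 1ℚ < q * r
  ; lower-inhabited = let u , xu = upper-inhabited x in
      0ℚ , u , xu , subst (_< 1ℚ) (sym (*-zeroˡ u)) 0<1
  ; upper-inhabited = let r , 0<r , xr = lower-open x 0<x ; q , qr≡2 = quot (1ℚ + 1ℚ) 0<r in
      q , r , xr , 0<r , subst (1ℚ <_) (sym qr≡2) (p<p+1 1ℚ)
  ; lower-down      = λ q<q′ (r , xr , q′r<1) →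
      r , xr , <-trans (monoˡ-< (lower<upper x 0<x xr) q<q′) q′r<1
  ; upper-up        = λ q<q′ (r , xr , 0<r , 1<qr) →
      r , xr , 0<r , <-trans 1<qr (monoˡ-< 0<r q<q′)
  ; lower-open      = λ {q} (r , xr , qr<1) →
      let 0<r = lower<upper x 0<x xr
          z , qr<z , z<1 = <-dense qr<1
          s , sr≡z = quot z 0<r
      in s , cancelʳ-< 0<r (subst (q * r <_) (sym sr≡z) qr<z)
           , r , xr , subst (_< 1ℚ) (sym sr≡z) z<1
  ; upper-open      = λ {q} (r , xr , 0<r , 1<qr) →
      let z , 1<z , z<qr = <-dense 1<qr
          s , sr≡z = quot z 0<r
      in s , cancelʳ-< 0<r (subst (_< q * r) (sym sr≡z) z<qr)
           , r , xr , 0<r , subst (1ℚ <_) (sym sr≡z) 1<z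
  ; disjoint        = λ {q} → dis {q}
  ; located         = loc
  }
  where
  dis : ∀ {q} → (∃[ r ] upper x r × q * r < 1ℚ) →
        (∃[ r ] lower x r × 0ℚ < r × 1ℚ < q * r) → ⊥
  dis {q} (r , xr , qr<1) (s , xs , 0<s , 1<qs) =
    <-asym (<-trans 1<qs (monoʳ-< 0<q (lower<upper x xs xr))) qr<1
    where
    0<q : 0ℚ < q
    0<q = cancelʳ-< 0<s (subst (_< q * s) (sym (*-zeroˡ s)) (<-trans 0<1 1<qs))

  loc : ∀ {q r} → q < r →
        (∃[ s ] upper x s × q * s < 1ℚ) ⊎ (∃[ s ] lower x s × 0ℚ < s × 1ℚ < r * s)
  loc {q} {r} q<r with 0ℚ <? q
  ... | no 0≮q =
    let u , xu = upper-inhabited x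
        0<u = lower<upper x 0<x xu
        qu≤0 = subst (q * u ≤_) (*-zeroˡ u)
                 (*-monoʳ-≤-nonNeg u {{nonNegative (<⇒≤ 0<u)}} (≮⇒≥ 0≮q))
    in inj₁ (u , xu , ≤-<-trans qu≤0 0<1)
  ... | yes 0<q =
    let 0<r = <-trans 0<q q<r
        u , ur≡1 = quot 1ℚ 0<r
        v , vq≡1 = quot 1ℚ 0<q
        u<v = cancelʳ-< {r * q} {u} {v} (*-pos 0<r 0<q) (subst₂ _<_
                (sym (trans (sym (*-assoc u r q)) (trans (cong (_* q) ur≡1) (*-identityˡ q))))
                (sym (trans (cong (v *_) (*-comm r q))
                  (trans (sym (*-assoc v q r)) (trans (cong (_* r) vq≡1) (*-identityˡ r)))))
                q<r)
        a , u<a , a<v = <-dense u<v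
        b , a<b , b<v = <-dense a<v
        1<ra = subst₂ _<_ ur≡1 (*-comm a r) (monoˡ-< {r} {u} {a} 0<r u<a)
        qb<1 = subst₂ _<_ (*-comm b q) vq≡1 (monoˡ-< {q} {b} {v} 0<q b<v)
        0<u = cancelʳ-< {r} {0ℚ} {u} 0<r (subst₂ _<_ (sym (*-zeroˡ r)) (sym ur≡1) 0<1)
    in [ (λ la → inj₂ (a , la , <-trans 0<u u<a , 1<ra))
       , (λ ub → inj₁ (b , ub , qb<1)) ] (located x a<b)

private

  -- Given s ≥ 0, the point (q (s+1) + s) / (q + s + 1) lies strictly between
  -- q and √s on the q-side of √s, or equals both.

  module Mediant {q s : ℚ} (0≤q : 0ℚ ≤ q) (0≤s : 0ℚ ≤ s) where
    w = q + (s + 1ℚ)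

    0<w : 0ℚ < w
    0<w = <-≤-trans (≤-<-trans 0≤s (p<p+1 s))
            (subst (s + 1ℚ ≤_) (+-comm (s + 1ℚ) q) (p≤p+q (s + 1ℚ) 0≤q))

    t = q * (s + 1ℚ) + s

    mid = proj₁ (quot t 0<w)

    mid*w : mid * w ≡ t
    mid*w = proj₂ (quot t 0<w)

    0<w*w : 0ℚ < w * w
    0<w*w = *-pos 0<w 0<w

    mid²w² : mid * mid * (w * w) ≡ t * t
    mid²w² = trans
      (solve 2 (λ m v → m :* m :* (v :* v) := m :* v :* (m :* v)) refl mid w)
      (cong₂ _*_ mid*w mid*w)

    q*w : q * w ≡ q * q + q * (s + 1ℚ)
    q*w = *-distribˡ-+ q q (s + 1ℚ)

    0≤s²+s+1 : 0ℚ ≤ s * s + (s + 1ℚ)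
    0≤s²+s+1 = ≤-trans (*-nonNeg 0≤s 0≤s)
      (p≤p+q (s * s) (≤-trans 0≤s (<⇒≤ (p<p+1 s))))

    below : q * q < s → q < mid × mid * mid ≤ s
    below q²<s =
      cancelʳ-< 0<w (subst₂ _<_ (sym q*w) (trans (+-comm s (q * (s + 1ℚ))) (sym mid*w))
        (+-monoˡ-< (q * (s + 1ℚ)) q²<s)) ,
      cancelʳ-≤ 0<w*w (subst₂ _≤_ (sym mid²w²)
        (solve 2 (λ q s → (q :* (s :+ con 1ℚ) :+ s) :* (q :* (s :+ con 1ℚ) :+ s)
                          :+ (s :- q :* q) :* (s :* s :+ (s :+ con 1ℚ))
                          := s :* ((q :+ (s :+ con 1ℚ)) :* (q :+ (s :+ con 1ℚ)))) refl q s)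
        (p≤p+q (t * t) (*-nonNeg (sub-nonNeg (<⇒≤ q²<s)) 0≤s²+s+1)))

    above : s < q * q → mid < q × s ≤ mid * mid
    above s<q² =
      cancelʳ-< 0<w (subst₂ _<_ (trans (+-comm s (q * (s + 1ℚ))) (sym mid*w)) (sym q*w)
        (+-monoˡ-< (q * (s + 1ℚ)) s<q²)) ,
      cancelʳ-≤ 0<w*w (subst (s * (w * w) ≤_)
        (trans
          (solve 2 (λ q s → s :* ((q :+ (s :+ con 1ℚ)) :* (q :+ (s :+ con 1ℚ)))
                            :+ (q :* q :- s) :* (s :* s :+ (s :+ con 1ℚ))
                            := (q :* (s :+ con 1ℚ) :+ s) :* (q :* (s :+ con 1ℚ) :+ s)) refl q s)
          (sym mid²w²))
        (p≤p+q (s * (w * w)) (*-nonNeg (sub-nonNeg (<⇒≤ s<q²)) 0≤s²+s+1)))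

    0<mid : 0ℚ < s → 0ℚ < mid
    0<mid 0<s = cancelʳ-< 0<w (subst₂ _<_ (sym (*-zeroˡ w)) (sym mid*w)
      (<-≤-trans 0<s (subst (s ≤_) (+-comm s _)
        (p≤p+q s (*-nonNeg 0≤q (≤-trans 0≤s (<⇒≤ (p<p+1 s))))))))

-- √ x is the square root of max(x, 0).

infix 8 √_

√_ : ℝ → ℝ
√ x = record
  { lower           = lo
  ; upper           = up
  ; lower-inhabited = - 1ℚ , inj₁ -1<0
  ; upper-inhabited = inh
  ; lower-down      = down
  ; upper-up        = λ q<r (0<q , u) →
      <-trans 0<q q<r , upper-up x (sq-mono-< (<⇒≤ 0<q) q<r) u
  ; lower-open      = open-lo
  ; upper-open      = open-up
  ; disjoint        = λ { (inj₁ q<0) (0<q , _) → <-asym q<0 0<q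
                        ; (inj₂ l)   (_ , u)   → disjoint x l u }
  ; located         = loc
  }
  where
  lo up : ℚ → Set
  lo q = q < 0ℚ ⊎ lower x (q * q)
  up q = 0ℚ < q × upper x (q * q)

  inh : ∃ up
  inh with upper-inhabited x
  ... | u , xu with u <? 1ℚ
  ...   | yes u<1 = 1ℚ , 0<1 , upper-up x u<1 xu
  ...   | no  u≮1 = u , <-≤-trans 0<1 1≤u , upper-up≤ x
            (subst (_≤ u * u) (*-identityʳ u)
              (*-monoˡ-≤-nonNeg u {{nonNegative (≤-trans (<⇒≤ 0<1) 1≤u)}} 1≤u)) xu
    where 1≤u = ≮⇒≥ u≮1

  down : ∀ {q r} → q < r → lo r → lo q
  down q<r (inj₁ r<0) = inj₁ (<-trans q<r r<0)
  down {q} q<r (inj₂ l) with q <? 0ℚ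
  ... | yes q<0 = inj₁ q<0
  ... | no  q≮0 = inj₂ (lower-down x (sq-mono-< (≮0⇒0≤ q≮0) q<r) l)

  open-lo : ∀ {q} → lo q → ∃[ r ] q < r × lo r
  open-lo (inj₁ q<0) = let r , q<r , r<0 = <-dense q<0 in r , q<r , inj₁ r<0
  open-lo {q} (inj₂ l) with q <? 0ℚ
  ... | yes q<0 = let r , q<r , r<0 = <-dense q<0 in r , q<r , inj₁ r<0
  ... | no  q≮0 =
    let s , q²<s , xs = lower-open x l
        0≤q = ≮0⇒0≤ q≮0
        0≤s = ≤-trans (*-nonNeg 0≤q 0≤q) (<⇒≤ q²<s)
        open Mediant 0≤q 0≤s
        q<mid , mid²≤s = below q²<s
    in mid , q<mid , inj₂ (lower-down≤ x mid²≤s xs)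

  open-up : ∀ {q} → up q → ∃[ r ] r < q × up r
  open-up {q} (0<q , u) with upper-open x u
  ... | s , s<q² , xs with 0ℚ <? s
  ...   | yes 0<s =
    let open Mediant (<⇒≤ 0<q) (<⇒≤ 0<s)
        mid<q , s≤mid² = above s<q²
    in mid , mid<q , 0<mid 0<s , upper-up≤ x s≤mid² xs
  ...   | no  0≮s =
    let r , 0<r , r<q = <-dense 0<q
    in r , r<q , 0<r , upper-up x (≤-<-trans (≮⇒≥ 0≮s) (*-pos 0<r 0<r)) xs

  loc : ∀ {q r} → q < r → lo q ⊎ up r
  loc {q} {r} q<r with q <? 0ℚ
  ... | yes q<0 = inj₁ (inj₁ q<0)
  ... | no  q≮0 with located x (sq-mono-< (≮0⇒0≤ q≮0) q<r)
  ...   | inj₁ l = inj₁ (inj₂ l)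
  ...   | inj₂ u = inj₂ (≤-<-trans (≮0⇒0≤ q≮0) q<r , u)

-- For n ≥ 1 and d ≥ 1, p / d < log₂ n iff 2 ^ p < n ^ d, and this always holds for p < 0.

log₂-lower : ℕ → ℚ → Set
log₂-lower n (mkℚ (+ p)    d-1 _) = 2 ℕ.^ p ℕ.< n ℕ.^ suc d-1
log₂-lower n (mkℚ -[1+ _ ] d-1 _) = Unit

log₂-upper : ℕ → ℚ → Set
log₂-upper n (mkℚ (+ p)    d-1 _) = n ℕ.^ suc d-1 ℕ.< 2 ℕ.^ p
log₂-upper n (mkℚ -[1+ _ ] d-1 _) = ⊥

private

  ^-comm-assoc : ∀ m a b → (m ℕ.^ a) ℕ.^ b ≡ m ℕ.^ (b ℕ.* a)
  ^-comm-assoc m a b = trans (ℕ.^-*-assoc m a b) (cong (m ℕ.^_) (ℕ.*-comm a b))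

  ^-swap : ∀ m a b → (m ℕ.^ a) ℕ.^ b ≡ (m ℕ.^ b) ℕ.^ a
  ^-swap m a b = trans (ℕ.^-*-assoc m a b) (sym (^-comm-assoc m b a))

  pow-lower : ∀ n p d p′ d′ → p ℕ.* suc d′ ℕ.≤ p′ ℕ.* suc d →
              2 ℕ.^ p′ ℕ.< n ℕ.^ suc d′ → 2 ℕ.^ p ℕ.< n ℕ.^ suc d
  pow-lower n p d p′ d′ le lt = ℕ.≰⇒> λ n^d≤2^p → ℕ.<-irrefl refl (begin-strict
    (2 ℕ.^ p′) ℕ.^ suc d   <⟨ ℕ.^-monoˡ-< (suc d) lt ⟩
    (n ℕ.^ suc d′) ℕ.^ suc d ≡⟨ ^-swap n (suc d′) (suc d) ⟩
    (n ℕ.^ suc d) ℕ.^ suc d′ ≤⟨ ℕ.^-monoˡ-≤ (suc d′) n^d≤2^p ⟩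
    (2 ℕ.^ p) ℕ.^ suc d′   ≡⟨ ℕ.^-*-assoc 2 p (suc d′) ⟩
    2 ℕ.^ (p ℕ.* suc d′)   ≤⟨ ℕ.^-monoʳ-≤ 2 le ⟩
    2 ℕ.^ (p′ ℕ.* suc d)   ≡⟨ ℕ.^-*-assoc 2 p′ (suc d) ⟨
    (2 ℕ.^ p′) ℕ.^ suc d   ∎)
    where open ℕ.≤-Reasoning

  pow-upper : ∀ n p d p′ d′ → p′ ℕ.* suc d ℕ.≤ p ℕ.* suc d′ →
              n ℕ.^ suc d′ ℕ.< 2 ℕ.^ p′ → n ℕ.^ suc d ℕ.< 2 ℕ.^ p
  pow-upper n p d p′ d′ le lt = ℕ.≰⇒> λ 2^p≤n^d → ℕ.<-irrefl refl (begin-strict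
    (n ℕ.^ suc d′) ℕ.^ suc d <⟨ ℕ.^-monoˡ-< (suc d) lt ⟩
    (2 ℕ.^ p′) ℕ.^ suc d   ≡⟨ ℕ.^-*-assoc 2 p′ (suc d) ⟩
    2 ℕ.^ (p′ ℕ.* suc d)   ≤⟨ ℕ.^-monoʳ-≤ 2 le ⟩
    2 ℕ.^ (p ℕ.* suc d′)   ≡⟨ ℕ.^-*-assoc 2 p (suc d′) ⟨
    (2 ℕ.^ p) ℕ.^ suc d′   ≤⟨ ℕ.^-monoˡ-≤ (suc d′) 2^p≤n^d ⟩
    (n ℕ.^ suc d) ℕ.^ suc d′ ≡⟨ ^-swap n (suc d) (suc d′) ⟩
    (n ℕ.^ suc d′) ℕ.^ suc d ∎)
    where open ℕ.≤-Reasoning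

  pow-located : ∀ n p d p′ d′ → p ℕ.* suc d′ ℕ.< p′ ℕ.* suc d →
                n ℕ.^ suc d ℕ.≤ 2 ℕ.^ p → n ℕ.^ suc d′ ℕ.< 2 ℕ.^ p′
  pow-located n p d p′ d′ lt le = ℕ.≰⇒> λ 2^p′≤n^d′ → ℕ.<-irrefl refl (begin-strict
    (2 ℕ.^ p) ℕ.^ suc d′   ≡⟨ ℕ.^-*-assoc 2 p (suc d′) ⟩
    2 ℕ.^ (p ℕ.* suc d′)   <⟨ ℕ.^-monoʳ-< 2 (ℕ.s≤s (ℕ.s≤s ℕ.z≤n)) lt ⟩
    2 ℕ.^ (p′ ℕ.* suc d)   ≡⟨ ℕ.^-*-assoc 2 p′ (suc d) ⟨
    (2 ℕ.^ p′) ℕ.^ suc d   ≤⟨ ℕ.^-monoˡ-≤ (suc d) 2^p′≤n^d′ ⟩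
    (n ℕ.^ suc d′) ℕ.^ suc d ≡⟨ ^-swap n (suc d′) (suc d) ⟩
    (n ℕ.^ suc d) ℕ.^ suc d′ ≤⟨ ℕ.^-monoˡ-≤ (suc d′) le ⟩
    (2 ℕ.^ p) ℕ.^ suc d′   ∎)
    where open ℕ.≤-Reasoning

  bernoulli : ∀ a k → a ℕ.^ k ℕ.* (a ℕ.+ k) ℕ.≤ a ℕ.* suc a ℕ.^ k
  bernoulli a zero = ℕ.≤-reflexive (trans (ℕ.*-identityˡ _)
    (trans (ℕ.+-identityʳ a) (sym (ℕ.*-identityʳ a))))
  bernoulli a (suc k) = begin
    a ℕ.* a ℕ.^ k ℕ.* (a ℕ.+ suc k)    ≡⟨ cong (ℕ._* (a ℕ.+ suc k)) (ℕ.*-comm a (a ℕ.^ k)) ⟩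
    a ℕ.^ k ℕ.* a ℕ.* (a ℕ.+ suc k)    ≡⟨ ℕ.*-assoc (a ℕ.^ k) a (a ℕ.+ suc k) ⟩
    a ℕ.^ k ℕ.* (a ℕ.* (a ℕ.+ suc k))  ≤⟨ ℕ.*-monoʳ-≤ (a ℕ.^ k) step ⟩
    a ℕ.^ k ℕ.* ((a ℕ.+ k) ℕ.* suc a)  ≡⟨ ℕ.*-assoc (a ℕ.^ k) (a ℕ.+ k) (suc a) ⟨
    a ℕ.^ k ℕ.* (a ℕ.+ k) ℕ.* suc a    ≤⟨ ℕ.*-monoˡ-≤ (suc a) (bernoulli a k) ⟩
    a ℕ.* suc a ℕ.^ k ℕ.* suc a        ≡⟨ ℕ.*-assoc a (suc a ℕ.^ k) (suc a) ⟩
    a ℕ.* (suc a ℕ.^ k ℕ.* suc a)      ≡⟨ cong (a ℕ.*_) (ℕ.*-comm (suc a ℕ.^ k) (suc a)) ⟩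
    a ℕ.* (suc a ℕ.* suc a ℕ.^ k)      ∎
    where
    open ℕ.≤-Reasoning
    step : a ℕ.* (a ℕ.+ suc k) ℕ.≤ (a ℕ.+ k) ℕ.* suc a
    step = begin
      a ℕ.* (a ℕ.+ suc k)               ≡⟨ cong (a ℕ.*_) (ℕ.+-suc a k) ⟩
      a ℕ.* suc (a ℕ.+ k)               ≡⟨ ℕ.*-suc a (a ℕ.+ k) ⟩
      a ℕ.+ a ℕ.* (a ℕ.+ k)             ≤⟨ ℕ.+-monoˡ-≤ (a ℕ.* (a ℕ.+ k)) (ℕ.m≤m+n a k) ⟩
      (a ℕ.+ k) ℕ.+ a ℕ.* (a ℕ.+ k)     ≡⟨ cong ((a ℕ.+ k) ℕ.+_) (ℕ.*-comm a (a ℕ.+ k)) ⟩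
      (a ℕ.+ k) ℕ.+ (a ℕ.+ k) ℕ.* a     ≡⟨ ℕ.*-suc (a ℕ.+ k) a ⟨
      (a ℕ.+ k) ℕ.* suc a               ∎

  pow-gap : ∀ a b .{{_ : NonZero a}} → a ℕ.< b → ∃[ k ] 2 ℕ.* a ℕ.^ suc k ℕ.< b ℕ.^ suc k
  pow-gap a@(suc a-1) b a<b = k , (begin-strict
    2 ℕ.* a ℕ.^ suc k     <⟨ ℕ.*-monoˡ-< (a ℕ.^ suc k) {{ℕ.m^n≢0 a (suc k)}} (ℕ.n<1+n 2) ⟩
    3 ℕ.* a ℕ.^ suc k     ≤⟨ ℕ.*-cancelˡ-≤ a (begin
      a ℕ.* (3 ℕ.* a ℕ.^ suc k)   ≡⟨ ℕ.*-assoc a 3 (a ℕ.^ suc k) ⟨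
      a ℕ.* 3 ℕ.* a ℕ.^ suc k     ≡⟨ ℕ.*-comm (a ℕ.* 3) (a ℕ.^ suc k) ⟩
      a ℕ.^ suc k ℕ.* (a ℕ.* 3)   ≡⟨ cong (a ℕ.^ suc k ℕ.*_) (ℕ.*-suc a 2) ⟩
      a ℕ.^ suc k ℕ.* (a ℕ.+ a ℕ.* 2) ≤⟨ bernoulli a (suc k) ⟩
      a ℕ.* suc a ℕ.^ suc k       ∎) ⟩
    suc a ℕ.^ suc k       ≤⟨ ℕ.^-monoˡ-≤ (suc k) a<b ⟩
    b ℕ.^ suc k           ∎)
    where
    open ℕ.≤-Reasoning
    k = suc (a-1 ℕ.* 2)

  n<2^n : ∀ n → n ℕ.< 2 ℕ.^ n
  n<2^n zero    = ℕ.s≤s ℕ.z≤n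
  n<2^n (suc n) = begin-strict
    suc n                   ≤⟨ n<2^n n ⟩
    2 ℕ.^ n                 <⟨ ℕ.m<m*n (2 ℕ.^ n) 2 {{ℕ.m^n≢0 2 n}} (ℕ.n<1+n 1) ⟩
    2 ℕ.^ n ℕ.* 2           ≡⟨ ℕ.*-comm (2 ℕ.^ n) 2 ⟩
    2 ℕ.* 2 ℕ.^ n           ∎
    where open ℕ.≤-Reasoning

  cross-< : ∀ {p d p′ d′} .{c : Coprime p (suc d)} .{c′ : Coprime p′ (suc d′)} →
            mkℚ (+ p) d c < mkℚ (+ p′) d′ c′ →
            p ℕ.* suc d′ ℕ.< p′ ℕ.* suc d
  cross-< {p} {d} {p′} {d′} (*<* lt) =
    ℤ.drop‿+<+ (subst₂ ℤ._<_ (sym (ℤ.pos-* p (suc d′))) (sym (ℤ.pos-* p′ (suc d))) lt)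

  uncross-< : ∀ {p d P D} .{c : Coprime p (suc d)} →
              p ℕ.* suc D ℕ.< P ℕ.* suc d → mkℚ (+ p) d c < + P / suc D
  uncross-< {p} {d} {P} {D} lt = toℚᵘ-cancel-< (ℚᵘ.<-respʳ-≃
    (ℚᵘ.≃-sym (toℚᵘ-fromℚᵘ (ℚᵘ.mkℚᵘ (+ P) D)))
    (ℚᵘ.*<* (subst₂ ℤ._<_ (ℤ.pos-* p (suc D)) (ℤ.pos-* P (suc d)) (ℤ.+<+ lt))))

  uncross-> : ∀ {p d P D} .{c : Coprime p (suc d)} →
              P ℕ.* suc d ℕ.< p ℕ.* suc D → + P / suc D < mkℚ (+ p) d c
  uncross-> {p} {d} {P} {D} lt = toℚᵘ-cancel-< (ℚᵘ.<-respˡ-≃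
    (ℚᵘ.≃-sym (toℚᵘ-fromℚᵘ (ℚᵘ.mkℚᵘ (+ P) D)))
    (ℚᵘ.*<* (subst₂ ℤ._<_ (ℤ.pos-* P (suc d)) (ℤ.pos-* p (suc D)) (ℤ.+<+ lt))))

  neg≮pos : ∀ {p d p′ d′} .{c : Coprime p (suc d)} .{c′ : Coprime (suc p′) (suc d′)} →
            ¬ mkℚ (+ p) d c < mkℚ -[1+ p′ ] d′ c′
  neg≮pos {p} {d} {p′} {d′} (*<* lt)
    with subst (ℤ._< -[1+ p′ ] ℤ.* + suc d) (sym (ℤ.pos-* p (suc d′))) lt
  ... | ()

  nonNeg-num : ∀ {p d} P D → ℚᵘ.mkℚᵘ -[1+ p ] d ℚᵘ.≃ ℚᵘ.mkℚᵘ (+ P) D → ⊥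
  nonNeg-num {p} {d} P D (ℚᵘ.*≡* eq)
    with trans eq (sym (ℤ.pos-* P (suc d)))
  ... | ()

  cross-≡ : ∀ p d P D → ℚᵘ.mkℚᵘ (+ p) d ℚᵘ.≃ ℚᵘ.mkℚᵘ (+ P) D → p ℕ.* suc D ≡ P ℕ.* suc d
  cross-≡ p d P D (ℚᵘ.*≡* eq) =
    ℤ.+-injective (trans (ℤ.pos-* p (suc D)) (trans eq (sym (ℤ.pos-* P (suc d)))))

  log₂-lower-/ : ∀ n P D → 2 ℕ.^ P ℕ.< n ℕ.^ suc D → log₂-lower n (+ P / suc D)
  log₂-lower-/ n P D lt = go (+ P / suc D) (toℚᵘ-fromℚᵘ (ℚᵘ.mkℚᵘ (+ P) D))
    where
    go : ∀ r → toℚᵘ r ℚᵘ.≃ ℚᵘ.mkℚᵘ (+ P) D → log₂-lower n r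
    go (mkℚ (+ p) d _)    eq = pow-lower n p d P D (ℕ.≤-reflexive (cross-≡ p d P D eq)) lt
    go (mkℚ -[1+ _ ] _ _) eq = tt

  log₂-upper-/ : ∀ n P D → n ℕ.^ suc D ℕ.< 2 ℕ.^ P → log₂-upper n (+ P / suc D)
  log₂-upper-/ n P D lt = go (+ P / suc D) (toℚᵘ-fromℚᵘ (ℚᵘ.mkℚᵘ (+ P) D))
    where
    go : ∀ r → toℚᵘ r ℚᵘ.≃ ℚᵘ.mkℚᵘ (+ P) D → log₂-upper n r
    go (mkℚ (+ p) d _)    eq = pow-upper n p d P D (ℕ.≤-reflexive (sym (cross-≡ p d P D eq))) lt
    go (mkℚ -[1+ _ ] _ _) eq = ⊥-elim (nonNeg-num P D eq)

log₂ : (n : ℕ) .{{_ : NonZero n}} → ℝ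
log₂ n = record
  { lower           = log₂-lower n
  ; upper           = log₂-upper n
  ; lower-inhabited = - 1ℚ , tt
  ; upper-inhabited = + n / 1 , log₂-upper-/ n n 0
      (subst (ℕ._< 2 ℕ.^ n) (sym (ℕ.^-identityʳ n)) (n<2^n n))
  ; lower-down      = λ {q} {r} → down q r
  ; upper-up        = λ {q} {r} → up q r
  ; lower-open      = λ {q} → open-lo q
  ; upper-open      = λ {q} → open-up q
  ; disjoint        = λ {q} → dis q
  ; located         = λ {q} {r} → loc q r
  }
  where
  down : ∀ q r → q < r → log₂-lower n r → log₂-lower n q
  down (mkℚ -[1+ _ ] _ _) _                  q<r l = tt
  down (mkℚ (+ p) d _)    (mkℚ (+ p′) d′ _)  q<r l = pow-lower n p d p′ d′ (ℕ.<⇒≤ (cross-< q<r)) l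
  down (mkℚ (+ _) _ _)    (mkℚ -[1+ _ ] _ _) q<r l = ⊥-elim (neg≮pos q<r)

  up : ∀ q r → q < r → log₂-upper n q → log₂-upper n r
  up (mkℚ (+ p) d _) (mkℚ (+ p′) d′ _)  q<r u = pow-upper n p′ d′ p d (ℕ.<⇒≤ (cross-< q<r)) u
  up (mkℚ (+ _) _ _) (mkℚ -[1+ _ ] _ _) q<r u = neg≮pos q<r

  dis : ∀ q → log₂-lower n q → log₂-upper n q → ⊥
  dis (mkℚ (+ _) _ _) l u = ℕ.<-asym l u

  loc : ∀ q r → q < r → log₂-lower n q ⊎ log₂-upper n r
  loc (mkℚ -[1+ _ ] _ _) _                  q<r = inj₁ tt
  loc (mkℚ (+ _) _ _)    (mkℚ -[1+ _ ] _ _) q<r = ⊥-elim (neg≮pos q<r)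
  loc (mkℚ (+ p) d _)    (mkℚ (+ p′) d′ _)  q<r with 2 ℕ.^ p ℕ.<? n ℕ.^ suc d
  ... | yes lt = inj₁ lt
  ... | no  ≮  = inj₂ (pow-located n p d p′ d′ (cross-< q<r) (ℕ.≮⇒≥ ≮))

  open-lo : ∀ q → log₂-lower n q → ∃[ r ] q < r × log₂-lower n r
  open-lo q@(mkℚ -[1+ _ ] _ _) _ = let r , q<r , r<0 = <-dense (negative⁻¹ q) in
    r , q<r , neg-lower r r<0
    where
    neg-lower : ∀ r → r < 0ℚ → log₂-lower n r
    neg-lower (mkℚ (+ _) _ _) r<0 = ⊥-elim (ℕ.n≮0 (cross-< r<0))
    neg-lower (mkℚ -[1+ _ ] _ _) _ = tt
  open-lo (mkℚ (+ p) d _) lt with pow-gap (2 ℕ.^ p) (n ℕ.^ suc d) {{ℕ.m^n≢0 2 p}} lt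
  ... | k , gap = + suc (p ℕ.* suc k) / suc (k ℕ.+ d ℕ.* suc k) ,
        uncross-< {P = suc (p ℕ.* suc k)} {D = k ℕ.+ d ℕ.* suc k} bound ,
        log₂-lower-/ n (suc (p ℕ.* suc k)) (k ℕ.+ d ℕ.* suc k) (subst₂ ℕ._<_
          (cong (2 ℕ.*_) (ℕ.^-*-assoc 2 p (suc k))) (ℕ.^-*-assoc n (suc d) (suc k)) gap)
    where
    open ℕ.≤-Reasoning
    bound : p ℕ.* (suc d ℕ.* suc k) ℕ.< suc (p ℕ.* suc k) ℕ.* suc d
    bound = begin-strict
      p ℕ.* (suc d ℕ.* suc k)         ≡⟨ cong (p ℕ.*_) (ℕ.*-comm (suc d) (suc k)) ⟩
      p ℕ.* (suc k ℕ.* suc d)         ≡⟨ ℕ.*-assoc p (suc k) (suc d) ⟨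
      p ℕ.* suc k ℕ.* suc d           <⟨ ℕ.*-monoˡ-< (suc d) (ℕ.n<1+n (p ℕ.* suc k)) ⟩
      suc (p ℕ.* suc k) ℕ.* suc d     ∎

  open-up : ∀ q → log₂-upper n q → ∃[ r ] r < q × log₂-upper n r
  open-up (mkℚ (+ zero) d _) lt = ⊥-elim (ℕ.<⇒≱ lt (ℕ.m^n>0 n (suc d)))
  open-up (mkℚ (+ suc p) d _) lt with pow-gap (n ℕ.^ suc d) (2 ℕ.^ suc p) {{ℕ.m^n≢0 n (suc d)}} lt
  ... | k , gap = + (k ℕ.+ p ℕ.* suc k) / suc (k ℕ.+ d ℕ.* suc k) ,
        uncross-> {P = k ℕ.+ p ℕ.* suc k} {D = k ℕ.+ d ℕ.* suc k} bound ,
        log₂-upper-/ n (k ℕ.+ p ℕ.* suc k) (k ℕ.+ d ℕ.* suc k) (ℕ.*-cancelˡ-< 2 _ _ (subst₂ ℕ._<_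
          (cong (2 ℕ.*_) (ℕ.^-*-assoc n (suc d) (suc k))) (ℕ.^-*-assoc 2 (suc p) (suc k)) gap))
    where
    open ℕ.≤-Reasoning
    bound : (k ℕ.+ p ℕ.* suc k) ℕ.* suc d ℕ.< suc p ℕ.* (suc d ℕ.* suc k)
    bound = begin-strict
      (k ℕ.+ p ℕ.* suc k) ℕ.* suc d   <⟨ ℕ.*-monoˡ-< (suc d) (ℕ.n<1+n (k ℕ.+ p ℕ.* suc k)) ⟩
      suc p ℕ.* suc k ℕ.* suc d       ≡⟨ ℕ.*-assoc (suc p) (suc k) (suc d) ⟩
      suc p ℕ.* (suc k ℕ.* suc d)     ≡⟨ cong (suc p ℕ.*_) (ℕ.*-comm (suc k) (suc d)) ⟩
      suc p ℕ.* (suc d ℕ.* suc k)     ∎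

log₂-lower? : ∀ n q → Dec (log₂-lower n q)
log₂-lower? n (mkℚ (+ p)    d-1 _) = 2 ℕ.^ p ℕ.<? n ℕ.^ suc d-1
log₂-lower? n (mkℚ -[1+ _ ] d-1 _) = yes tt

√-lower? : ∀ x → (∀ q → Dec (lower x q)) → ∀ q → Dec (lower (√ x) q)
√-lower? x lower? q = q <? 0ℚ ⊎-dec lower? (q * q)

IsCeiling : ℝ → ℕ → Set
IsCeiling x k = ofℚ ((+ k ℤ.- + 1) / 1) <ᵣ x × x ≤ᵣ ofℕ k

-- The ceiling of a real need not be computable; it is when the lower cut is decidable.
-- The hypothesis -1 < x makes it a natural number.

ceiling : ∀ x → (∀ q → Dec (lower x q)) → lower x (- 1ℚ) → ∃ (IsCeiling x)
ceiling x lower? -1<x = search bound 0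
  (subst (λ m → ¬ lower x (+ m / 1)) (sym (ℕ.+-identityʳ bound)) x≤bound) -1<x
  where
  integer-bound : ∀ q → q ≤ + ℤ.∣ ↥ q ∣ / 1
  integer-bound (mkℚ z d c) = toℚᵘ-cancel-≤ (ℚᵘ.≤-respʳ-≃
    (ℚᵘ.≃-sym (toℚᵘ-fromℚᵘ (ℚᵘ.mkℚᵘ (+ ℤ.∣ z ∣) 0)))
    (ℚᵘ.*≤* (ℤ.≤-trans (ℤ.≤-reflexive (ℤ.*-identityʳ z)) (le z))))
    where
    le : ∀ z → z ℤ.≤ + ℤ.∣ z ∣ ℤ.* + suc d
    le (+ m)    = subst (+ m ℤ.≤_) (ℤ.pos-* m (suc d)) (ℤ.+≤+ (ℕ.m≤m*n m (suc d)))
    le -[1+ m ] = subst (-[1+ m ] ℤ.≤_) (ℤ.pos-* (suc m) (suc d)) ℤ.-≤+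

  bound : ℕ
  bound = ℤ.∣ ↥ (proj₁ (upper-inhabited x)) ∣

  x≤bound : ¬ lower x (+ bound / 1)
  x≤bound l = disjoint x l
    (upper-up≤ x (integer-bound (proj₁ (upper-inhabited x))) (proj₂ (upper-inhabited x)))

  search : ∀ fuel k → ¬ lower x (+ (fuel ℕ.+ k) / 1) → lower x ((+ k ℤ.- + 1) / 1) →
           ∃ (IsCeiling x)
  search zero k x≤k k-1<x =
    k , lower-open x k-1<x , λ q q<x → ≰⇒> λ k≤q → x≤k (lower-down≤ x k≤q q<x)
  search (suc fuel) k x≤fuel+k k-1<x with lower? (+ k / 1)
  ... | no  k≮x = search zero k k≮x k-1<x
  ... | yes k<x = search fuel (suc k)
    (λ l → x≤fuel+k (subst (λ m → lower x (+ m / 1)) (ℕ.+-suc fuel k) l)) k<x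

⌈√_⌉ : ℕ → ℕ
⌈√ n ⌉ = proj₁ (ceiling (√ ofℕ n) (√-lower? (ofℕ n) (_<? + n / 1)) (inj₁ -1<0))

⌈√log₂_⌉ : (n : ℕ) .{{_ : NonZero n}} → ℕ
⌈√log₂ n ⌉ = proj₁ (ceiling (√ log₂ n) (√-lower? (log₂ n) (log₂-lower? n)) (inj₁ -1<0))

⌈√⌉-isCeiling : ∀ n → IsCeiling (√ ofℕ n) ⌈√ n ⌉
⌈√⌉-isCeiling n = proj₂ (ceiling (√ ofℕ n) (√-lower? (ofℕ n) (_<? + n / 1)) (inj₁ -1<0))

⌈√log₂⌉-isCeiling : ∀ n .{{_ : NonZero n}} → IsCeiling (√ log₂ n) ⌈√log₂ n ⌉
⌈√log₂⌉-isCeiling n = proj₂ (ceiling (√ log₂ n) (√-lower? (log₂ n) (log₂-lower? n)) (inj₁ -1<0))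

n/log₂ : (n : ℕ) .{{_ : NonTrivial n}} → ℝ
n/log₂ n = (+ n / 1) • reciprocal (log₂ n) 0<log₂n
  where
  instance
    n≢0 = ℕ.nonTrivial⇒nonZero n
    n>0 = normalize-pos n 1
  0<log₂n : log₂-lower n 0ℚ
  0<log₂n = subst (1 ℕ.<_) (sym (ℕ.^-identityʳ n)) (ℕ.nonTrivial⇒n>1 n)

data Letter : Set where
  a b : Letter

Word : Set
Word = List Letter

infixr 8 _^ʷ_

_^ʷ_ : Word → ℕ → Word
u ^ʷ m = concat (replicate m u)

Automaton : ℕ → Set
Automaton n = Fin n → Letter → Fin n

δ⟨_⟩ : ∀ {n} → Word → Automaton n → Fin n → Fin n
δ⟨ ω ⟩ δ x = foldl δ x ω

image : ∀ {n} → (Fin n → Fin n) → Subset n → Subset n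
image f B = tabulate λ y → does (any? λ x → x ∈? B ×-dec f x ≟ᶠ y)

code : Letter → Fin 2
code a = zero
code b = suc zero

decode : Fin 2 → Letter
decode zero       = a
decode (suc zero) = b

code-decode : ∀ i → code (decode i) ≡ i
code-decode zero       = refl
code-decode (suc zero) = refl

decode-code : ∀ c → decode (code c) ≡ c
decode-code a = refl
decode-code b = refl

-- Index i encodes the table of δ in base n; every automaton has exactly one index, up to
-- pointwise equality, so the uniform distribution on indices is uniform on automata.

automaton : ∀ {n} → Fin (n ℕ.^ (n ℕ.* 2)) → Automaton n
automaton i x c = finToFun i (combine x (code c))

automaton-surjective : ∀ {n} (δ : Automaton n) → ∃[ i ] (∀ x c → automaton i x c ≡ δ x c)
automaton-surjective {n} δ = funToFin f , λ x c →
  trans (finToFun-funToFin f (combine x (code c)))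
    (trans (cong g (remQuot-combine {n} {2} x (code c))) (cong (δ x) (decode-code c)))
  where
  g : Fin n × Fin 2 → Fin n
  g (x , j) = δ x (decode j)
  f : Fin (n ℕ.* 2) → Fin n
  f k = g (remQuot 2 k)

automaton-injective : ∀ {n} (i j : Fin (n ℕ.^ (n ℕ.* 2))) →
                      (∀ x c → automaton i x c ≡ automaton j x c) → i ≡ j
automaton-injective {n} i j eq = trans (sym (funToFin-finToFin {n ℕ.* 2} i))
  (trans (funToFin-cong _ _ pointwise) (funToFin-finToFin {n ℕ.* 2} j))
  where
  funToFin-cong : ∀ {m} (f g : Fin m → Fin n) → (∀ k → f k ≡ g k) → funToFin f ≡ funToFin g
  funToFin-cong {zero}  f g f≗g = refl
  funToFin-cong {suc m} f g f≗g =
    cong₂ combine (f≗g zero) (funToFin-cong (λ k → f (suc k)) (λ k → g (suc k)) (λ k → f≗g (suc k)))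
  pointwise : ∀ k → finToFun {n} {n ℕ.* 2} i k ≡ finToFun j k
  pointwise k = subst (λ l → finToFun {n} {n ℕ.* 2} i l ≡ finToFun j l)
    (trans (cong (combine {n} (quotient 2 k)) (code-decode (remainder {n} 2 k))) (combine-remQuot {n} 2 k))
    (eq (quotient 2 k) (decode (remainder {n} 2 k)))

𝔼 : ∀ {n} .{{_ : NonZero n}} → (Automaton n → ℕ) → ℚ
𝔼 {n} X = + sum (λ i → X (automaton i)) / (n ℕ.^ (n ℕ.* 2))
  where instance _ = ℕ.m^n≢0 n (n ℕ.* 2)

ω : (n : ℕ) .{{_ : NonZero n}} → Word
ω n = aᵏ ++ ((b ∷ aᵏ) ^ʷ ⌈√log₂ n ⌉)
  where aᵏ = (a ∷ []) ^ʷ ⌈√ n ⌉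

A : ∀ {n} .{{_ : NonZero n}} → Automaton n → Subset n
A {n} δ = image (δ⟨ ω n ⟩ δ) ⊤

𝔼∣A∣ : (n : ℕ) .{{_ : NonTrivial n}} → ℚ
𝔼∣A∣ n = 𝔼 {n} λ δ → ∣ A δ ∣
  where instance _ = ℕ.nonTrivial⇒nonZero n

infix 4 _=O_

-- Big-O as n → ∞ for nonnegative sequences indexed by n ≥ 2.

_=O_ : (f g : (n : ℕ) .{{_ : NonTrivial n}} → ℝ) → Set
f =O g = Σ[ C ∈ ℚ ] Σ[ C>0 ∈ Positive C ] Σ[ N ∈ ℕ ]
  (∀ n .{{_ : NonTrivial n}} → N ℕ.≤ n → f n ≤ᵣ _•_ C {{C>0}} (g n))

{-# OPTIONS --safe #-}
-- Write f = δ_a, g = δ_b and φ = f^s. Then A is the image of h^k restricted to φ([n]), where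
-- h = φ ∘ g, and conditionally on f the values of h are independent and identically
-- distributed on the M-point set φ([n]). The main estimate is, for every fixed φ,
--
--   (k + 1) 𝔼_g |h^k(φ[n])| ≤ 64 M + 2 (k + 1)².
--
-- Let T_j be the set of points first visited at time exactly j by some orbit starting in φ[n];
-- it is decreasing in j, and |T_j| - |T_{j+1}| is at least half the number of x ∈ T_j whose
-- h-image is shared with another point of T_j. Membership x ∈ T_j does not depend on g x, so
-- resampling g x makes x such a point whenever the new value of h x lies in T_{j+1} off the
-- orbit of x. Points y of small mass |φ⁻¹ y| make up at most 𝔼 |T_j| / 4 of T_{j+1},
-- hence roughly 𝔼 |T_j| - 𝔼 |T_{j+1}| ≥ c (𝔼 |T_{j+1}|)² / M, which forces 𝔼 |T_j| = O(M / j + j).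
-- Points of h^k(φ[n]) outside T_k return to themselves within k + 1 steps, and there are at
-- most k + 1 of those on average.
--
-- The case φ = id, k = s ≈ √n gives 𝔼 M = O(√n); the case φ = f^s, k ≈ √log n then gives
-- 𝔼 |A| = O(√n / k).
module Submission where

open import Defs

open import Data.Empty using (⊥-elim)
open import Data.Fin using (Fin; zero; suc; fromℕ<; _↑ˡ_; _↑ʳ_; combine; finToFun)
open import Data.Fin.Properties using (any?; remQuot-combine) renaming (_≟_ to _≟ᶠ_)
open import Data.Fin.Subset using (∣_∣; ⊤)
open import Data.Fin.Subset.Properties using (_∈?_; ∈⊤)
import Data.Integer as ℤ
import Data.Integer.Properties as ℤ
open import Data.List using (List; []; _∷_; _++_; length; map; allFin; tabulate; cartesianProductWith)
open import Data.List.Properties using (length-tabulate; foldl-++)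
open import Data.Nat
open import Data.Nat.Coprimality as Coprimality using (1-coprimeTo)
open import Data.Nat.GeneralisedArithmetic using (iterate)
open import Data.Nat.Properties
open import Algebra.Properties.Semiring.Sum +-*-semiring using (sum)
open import Data.Nat.Tactic.RingSolver using (solve-∀)
open import Data.Product using (∃; _×_; _,_; proj₁; proj₂)
open import Data.Rational as ℚ using (ℚ; mkℚ; 0ℚ; 1ℚ; Positive)
import Data.Rational.Properties as ℚ
open import Data.Rational.Solver using (module +-*-Solver)
open import Data.Rational.Unnormalised as ℚᵘ using (mkℚᵘ)
import Data.Rational.Unnormalised.Properties as ℚᵘ
open import Data.Sum using (_⊎_; inj₁; inj₂)
open import Data.Unit using (tt)
import Data.Vec as Vec′
import Data.Vec.Functional as Vec
open import Function using (_∘_; id; const)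
open import Relation.Binary.PropositionalEquality hiding (J)
open import Relation.Nullary using (¬_; Dec; does; yes; no; ¬?)
open import Relation.Nullary.Decidable using (_×-dec_; _⊎-dec_)
open +-*-Solver using (solve; _:*_; _:=_)

private variable
  X Y Z : Set
  P Q : Set
  n : ℕ

-- Finite sums over lists.

∑ : List X → (X → ℕ) → ℕ
∑ []       f = 0
∑ (x ∷ xs) f = f x + ∑ xs f

infix 5 ∑-syntax
∑-syntax = ∑
syntax ∑-syntax xs (λ x → e) = ∑[ x ∈ xs ] e

∑-cong : ∀ (xs : List X) {f g : X → ℕ} → (∀ x → f x ≡ g x) → ∑ xs f ≡ ∑ xs g
∑-cong []       eq = refl
∑-cong (x ∷ xs) eq = cong₂ _+_ (eq x) (∑-cong xs eq)

∑-mono : ∀ (xs : List X) {f g : X → ℕ} → (∀ x → f x ≤ g x) → ∑ xs f ≤ ∑ xs g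
∑-mono []       le = z≤n
∑-mono (x ∷ xs) le = +-mono-≤ (le x) (∑-mono xs le)

∑-distrib-+ : ∀ (xs : List X) (f g : X → ℕ) → ∑[ x ∈ xs ] (f x + g x) ≡ ∑ xs f + ∑ xs g
∑-distrib-+ []       f g = refl
∑-distrib-+ (x ∷ xs) f g = trans (cong (f x + g x +_) (∑-distrib-+ xs f g))
  (interchange (f x) (g x) (∑ xs f) (∑ xs g))
  where
  interchange : ∀ p q r s → p + q + (r + s) ≡ p + r + (q + s)
  interchange = solve-∀

∑-distribˡ-* : ∀ c (xs : List X) (f : X → ℕ) → ∑[ x ∈ xs ] c * f x ≡ c * ∑ xs f
∑-distribˡ-* c []       f = sym (*-zeroʳ c)
∑-distribˡ-* c (x ∷ xs) f =
  trans (cong (c * f x +_) (∑-distribˡ-* c xs f)) (sym (*-distribˡ-+ c (f x) (∑ xs f)))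

∑-distribʳ-* : ∀ c (xs : List X) (f : X → ℕ) → ∑[ x ∈ xs ] f x * c ≡ ∑ xs f * c
∑-distribʳ-* c xs f = trans (∑-cong xs λ x → *-comm (f x) c)
  (trans (∑-distribˡ-* c xs f) (*-comm c (∑ xs f)))

∑-const : ∀ (xs : List X) c → ∑[ _ ∈ xs ] c ≡ length xs * c
∑-const []       c = refl
∑-const (x ∷ xs) c = cong (c +_) (∑-const xs c)

∑-swap : ∀ (xs : List X) (ys : List Y) (f : X → Y → ℕ) →
         ∑[ x ∈ xs ] ∑[ y ∈ ys ] f x y ≡ ∑[ y ∈ ys ] ∑[ x ∈ xs ] f x y
∑-swap []       ys f = sym (trans (∑-const ys 0) (*-zeroʳ (length ys)))
∑-swap (x ∷ xs) ys f = trans (cong (∑ ys (f x) +_) (∑-swap xs ys f))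
  (sym (∑-distrib-+ ys (f x) (λ y → ∑[ x′ ∈ xs ] f x′ y)))

∑-map : ∀ (g : X → Y) xs (f : Y → ℕ) → ∑ (map g xs) f ≡ ∑ xs (f ∘ g)
∑-map g []       f = refl
∑-map g (x ∷ xs) f = cong (f (g x) +_) (∑-map g xs f)

∑-++ : ∀ (xs ys : List X) f → ∑ (xs ++ ys) f ≡ ∑ xs f + ∑ ys f
∑-++ []       ys f = refl
∑-++ (x ∷ xs) ys f = trans (cong (f x +_) (∑-++ xs ys f)) (sym (+-assoc (f x) _ _))

∑-cartesianProductWith : ∀ (_⊗_ : X → Y → Z) xs ys (f : Z → ℕ) →
  ∑ (cartesianProductWith _⊗_ xs ys) f ≡ ∑[ x ∈ xs ] ∑[ y ∈ ys ] f (x ⊗ y)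
∑-cartesianProductWith _⊗_ []       ys f = refl
∑-cartesianProductWith _⊗_ (x ∷ xs) ys f = trans
  (∑-++ (map (x ⊗_) ys) (cartesianProductWith _⊗_ xs ys) f)
  (cong₂ _+_ (∑-map (x ⊗_) ys f) (∑-cartesianProductWith _⊗_ xs ys f))

∑-tabulate : ∀ (g : Fin n → X) f → ∑ (tabulate g) f ≡ ∑ (allFin n) (f ∘ g)
∑-tabulate {n = zero}  g f = refl
∑-tabulate {n = suc n} g f = cong (f (g zero) +_)
  (trans (∑-tabulate (g ∘ suc) f) (sym (∑-tabulate suc (f ∘ g))))

∑-allFin-suc : ∀ (f : Fin (suc n) → ℕ) → ∑ (allFin (suc n)) f ≡ f zero + ∑ (allFin n) (f ∘ suc)
∑-allFin-suc f = cong (f zero +_) (∑-tabulate suc f)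

∑-allFin-const : ∀ n c → ∑[ _ ∈ allFin n ] c ≡ n * c
∑-allFin-const n c = trans (∑-const (allFin n) c) (cong (_* c) (length-tabulate {n = n} (λ i → i)))

-- Indicators of decidable propositions and counting with them.

⟦_⟧ : Dec P → ℕ
⟦ yes _ ⟧ = 1
⟦ no _ ⟧  = 0

⟦⟧≤1 : (P? : Dec P) → ⟦ P? ⟧ ≤ 1
⟦⟧≤1 (yes _) = ≤-refl
⟦⟧≤1 (no _)  = z≤n

⟦⟧-yes : (P? : Dec P) → P → ⟦ P? ⟧ ≡ 1
⟦⟧-yes (yes _) p = refl
⟦⟧-yes (no ¬p) p = ⊥-elim (¬p p)

⟦⟧-no : (P? : Dec P) → ¬ P → ⟦ P? ⟧ ≡ 0
⟦⟧-no (yes p) ¬p = ⊥-elim (¬p p)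
⟦⟧-no (no _)  ¬p = refl

⟦⟧-mono : (P? : Dec P) (Q? : Dec Q) → (P → Q) → ⟦ P? ⟧ ≤ ⟦ Q? ⟧
⟦⟧-mono (yes p) Q? f = ≤-reflexive (sym (⟦⟧-yes Q? (f p)))
⟦⟧-mono (no _)  Q? f = z≤n

⟦⟧-cong : (P? : Dec P) (Q? : Dec Q) → (P → Q) → (Q → P) → ⟦ P? ⟧ ≡ ⟦ Q? ⟧
⟦⟧-cong P? Q? f g = ≤-antisym (⟦⟧-mono P? Q? f) (⟦⟧-mono Q? P? g)

⟦⟧-⊎ : (P? : Dec P) (Q? : Dec Q) → ⟦ P? ⊎-dec Q? ⟧ ≤ ⟦ P? ⟧ + ⟦ Q? ⟧
⟦⟧-⊎ (yes _) Q?      = m≤m+n 1 _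
⟦⟧-⊎ (no _)  (yes _) = ≤-refl
⟦⟧-⊎ (no _)  (no _)  = ≤-refl

⟦⟧-× : (P? : Dec P) (Q? : Dec Q) → ⟦ P? ×-dec Q? ⟧ ≡ ⟦ P? ⟧ * ⟦ Q? ⟧
⟦⟧-× (yes _) (yes _) = refl
⟦⟧-× (yes _) (no _)  = refl
⟦⟧-× (no _)  Q?      = refl

∑-point : ∀ i (f : Fin n → ℕ) → ∑[ y ∈ allFin n ] ⟦ i ≟ᶠ y ⟧ * f y ≡ f i
∑-point {suc n} i f = trans (∑-allFin-suc (λ y → ⟦ i ≟ᶠ y ⟧ * f y)) (go i)
  where
  go : ∀ i → ⟦ i ≟ᶠ zero ⟧ * f zero + (∑[ y ∈ allFin n ] ⟦ i ≟ᶠ suc y ⟧ * f (suc y)) ≡ f i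
  go zero    = trans (cong (1 * f zero +_) (trans (∑-cong (allFin n) λ _ → refl)
    (trans (∑-allFin-const n 0) (*-zeroʳ n)))) (trans (+-identityʳ _) (*-identityˡ _))
  go (suc i) = trans (∑-cong (allFin n) λ y →
    cong (_* f (suc y)) (⟦⟧-cong (suc i ≟ᶠ suc y) (i ≟ᶠ y) (λ { refl → refl }) (cong suc)))
    (∑-point i (f ∘ suc))

∑-point₁ : ∀ (i : Fin n) → ∑[ y ∈ allFin n ] ⟦ i ≟ᶠ y ⟧ ≡ 1
∑-point₁ i = trans (∑-cong (allFin _) λ y → sym (*-identityʳ ⟦ i ≟ᶠ y ⟧)) (∑-point i (const 1))

-- Double counting along the fibres of `f`. The weight takes the value of `f` as a separate
-- argument, so that on the right a factor depending on this value alone is constant in the inner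
-- sum.
∑-fibres : ∀ (xs : List X) (f : X → Fin n) (w : X → Fin n → ℕ) →
           ∑[ x ∈ xs ] w x (f x) ≡ ∑[ y ∈ allFin n ] ∑[ x ∈ xs ] ⟦ f x ≟ᶠ y ⟧ * w x y
∑-fibres xs f w = trans (∑-cong xs λ x → sym (∑-point (f x) (w x)))
  (∑-swap xs (allFin _) λ x y → ⟦ f x ≟ᶠ y ⟧ * w x y)

∑-pos : ∀ {P : Fin n → Set} (P? : ∀ x → Dec (P x)) {x} → P x → 1 ≤ ∑[ x ∈ allFin n ] ⟦ P? x ⟧
∑-pos P? {x} p = ≤-trans (≤-reflexive (sym (∑-point₁ x)))
  (∑-mono (allFin _) λ y → ⟦⟧-mono (x ≟ᶠ y) (P? y) λ { refl → p })

∑-two : ∀ {P : Fin n → Set} (P? : ∀ x → Dec (P x)) {x x′} → x′ ≢ x → P x → P x′ →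
        2 ≤ ∑[ x ∈ allFin n ] ⟦ P? x ⟧
∑-two {n} P? {x} {x′} x′≢x p p′ = begin
  2
    ≡⟨ cong₂ _+_ (∑-point₁ x) (∑-point₁ x′) ⟨
  (∑[ y ∈ allFin n ] ⟦ x ≟ᶠ y ⟧) + (∑[ y ∈ allFin n ] ⟦ x′ ≟ᶠ y ⟧)
    ≡⟨ ∑-distrib-+ (allFin n) (λ y → ⟦ x ≟ᶠ y ⟧) (λ y → ⟦ x′ ≟ᶠ y ⟧) ⟨
  ∑[ y ∈ allFin n ] (⟦ x ≟ᶠ y ⟧ + ⟦ x′ ≟ᶠ y ⟧)
    ≤⟨ ∑-mono (allFin n) pointwise ⟩
  ∑[ y ∈ allFin n ] ⟦ P? y ⟧
    ∎
  where
  open ≤-Reasoning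
  pointwise : ∀ y → ⟦ x ≟ᶠ y ⟧ + ⟦ x′ ≟ᶠ y ⟧ ≤ ⟦ P? y ⟧
  pointwise y with x ≟ᶠ y | x′ ≟ᶠ y
  ... | yes refl | yes refl = ⊥-elim (x′≢x refl)
  ... | yes refl | no _     = ≤-reflexive (sym (⟦⟧-yes (P? y) p))
  ... | no _     | yes refl = ≤-reflexive (sym (⟦⟧-yes (P? y) p′))
  ... | no _     | no _     = z≤n

-- The space of all maps, and resampling of one value.

functions : ∀ m n → List (Fin m → Fin n)
functions zero    n = (λ ()) ∷ []
functions (suc m) n = cartesianProductWith Vec._∷_ (allFin n) (functions m n)

∑-functions-suc : ∀ m n (F : (Fin (suc m) → Fin n) → ℕ) →
  ∑ (functions (suc m) n) F ≡ ∑[ z ∈ allFin n ] ∑[ g ∈ functions m n ] F (z Vec.∷ g)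
∑-functions-suc m n F = ∑-cartesianProductWith Vec._∷_ (allFin n) (functions m n) F

length-functions : ∀ m n → length (functions m n) ≡ n ^ m
length-functions m n = trans (sym (trans (∑-const (functions m n) 1) (*-identityʳ _))) (total m)
  where
  total : ∀ m → ∑[ _ ∈ functions m n ] 1 ≡ n ^ m
  total zero    = refl
  total (suc m) = trans (∑-functions-suc m n (const 1))
    (trans (∑-cong (allFin n) λ _ → total m) (∑-allFin-const n (n ^ m)))

infixl 9 _[_↦_]

-- The recursion goes through `Vec.∷`, like that of `functions`, so that updating `y Vec.∷ g`
-- reduces to a map of the same form. This lets `∑-resample` hold for arbitrary `F`, without
-- function extensionality.
_[_↦_] : ∀ {m} → (Fin m → Fin n) → Fin m → Fin n → Fin m → Fin n
g [ zero  ↦ z ] = z Vec.∷ Vec.tail g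
g [ suc x ↦ z ] = Vec.head g Vec.∷ (Vec.tail g [ x ↦ z ])

[↦]-updates : ∀ {m} (g : Fin m → Fin n) x z → (g [ x ↦ z ]) x ≡ z
[↦]-updates g zero    z = refl
[↦]-updates g (suc x) z = [↦]-updates (Vec.tail g) x z

[↦]-minimal : ∀ {m} (g : Fin m → Fin n) x z {v} → v ≢ x → (g [ x ↦ z ]) v ≡ g v
[↦]-minimal g zero    z {zero}  v≢x = ⊥-elim (v≢x refl)
[↦]-minimal g zero    z {suc v} v≢x = refl
[↦]-minimal g (suc x) z {zero}  v≢x = refl
[↦]-minimal g (suc x) z {suc v} v≢x = [↦]-minimal (Vec.tail g) x z (v≢x ∘ cong suc)

-- Each map arises from exactly `n` pairs `(g , z)`, one for every forgotten value `g x`. The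
-- independence of the values of a random map enters the proof in this form: a quantity that does
-- not depend on `g x` may be combined with a fresh value `z`.
∑-resample : ∀ {m} (x : Fin m) (F : (Fin m → Fin n) → ℕ) →
  ∑[ g ∈ functions m n ] ∑[ z ∈ allFin n ] F (g [ x ↦ z ]) ≡ n * ∑ (functions m n) F
∑-resample {n} {suc m} zero F = begin
  ∑[ g ∈ functions (suc m) n ] ∑[ z ∈ allFin n ] F (g [ zero ↦ z ])
    ≡⟨ ∑-functions-suc m n _ ⟩
  ∑[ _ ∈ allFin n ] ∑[ g ∈ functions m n ] ∑[ z ∈ allFin n ] F (z Vec.∷ g)
    ≡⟨ ∑-allFin-const n _ ⟩
  n * (∑[ g ∈ functions m n ] ∑[ z ∈ allFin n ] F (z Vec.∷ g))
    ≡⟨ cong (n *_) (∑-swap (functions m n) (allFin n) λ g z → F (z Vec.∷ g)) ⟩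
  n * (∑[ z ∈ allFin n ] ∑[ g ∈ functions m n ] F (z Vec.∷ g))
    ≡⟨ cong (n *_) (∑-functions-suc m n F) ⟨
  n * ∑ (functions (suc m) n) F
    ∎
  where open ≡-Reasoning
∑-resample {n} {suc m} (suc x) F = begin
  ∑[ g ∈ functions (suc m) n ] ∑[ z ∈ allFin n ] F (g [ suc x ↦ z ])
    ≡⟨ ∑-functions-suc m n _ ⟩
  ∑[ y ∈ allFin n ] ∑[ g ∈ functions m n ] ∑[ z ∈ allFin n ] F (y Vec.∷ (g [ x ↦ z ]))
    ≡⟨ ∑-cong (allFin n) (λ y → ∑-resample x (λ g → F (y Vec.∷ g))) ⟩
  ∑[ y ∈ allFin n ] n * (∑[ g ∈ functions m n ] F (y Vec.∷ g))
    ≡⟨ ∑-distribˡ-* n (allFin n) _ ⟩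
  n * (∑[ y ∈ allFin n ] ∑[ g ∈ functions m n ] F (y Vec.∷ g))
    ≡⟨ cong (n *_) (∑-functions-suc m n F) ⟨
  n * ∑ (functions (suc m) n) F
    ∎
  where open ≡-Reasoning

-- First hitting times

FirstHit : (Fin n → Fin n) → ℕ → Fin n → Fin n → Set
FirstHit h zero    v x = v ≡ x
FirstHit h (suc j) v x = v ≢ x × FirstHit h j (h v) x

Visits : (Fin n → Fin n) → ℕ → Fin n → Fin n → Set
Visits h zero    v x = v ≡ x
Visits h (suc j) v x = v ≡ x ⊎ Visits h j (h v) x

firstHit? : ∀ (h : Fin n → Fin n) j v x → Dec (FirstHit h j v x)
firstHit? h zero    v x = v ≟ᶠ x
firstHit? h (suc j) v x = ¬? (v ≟ᶠ x) ×-dec firstHit? h j (h v) x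

visits? : ∀ (h : Fin n → Fin n) j v x → Dec (Visits h j v x)
visits? h zero    v x = v ≟ᶠ x
visits? h (suc j) v x = (v ≟ᶠ x) ⊎-dec visits? h j (h v) x

FirstHit⇒Visits : ∀ (h : Fin n → Fin n) j {v x} → FirstHit h j v x → Visits h j v x
FirstHit⇒Visits h zero    hit       = hit
FirstHit⇒Visits h (suc j) (_ , hit) = inj₂ (FirstHit⇒Visits h j hit)

Visits-suc : ∀ (h : Fin n → Fin n) j {v x} → Visits h j v x → Visits h (suc j) v x
Visits-suc h zero    v≡x          = inj₁ v≡x
Visits-suc h (suc j) (inj₁ v≡x)   = inj₁ v≡x
Visits-suc h (suc j) (inj₂ visit) = inj₂ (Visits-suc h j visit)

iterate⇒Visits : ∀ (h : Fin n → Fin n) k {v x} → iterate h v k ≡ x → Visits h k v x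
iterate⇒Visits h zero    eq = eq
iterate⇒Visits h (suc k) eq = inj₂ (iterate⇒Visits h k eq)

-- If the orbit meets `x` before time `k`, its remainder leads from `x` back to `x`. The return
-- takes at most `k + 1` steps, the first of which is already made in `h x`.
iterate⇒FirstHit⊎cyclic : ∀ (h : Fin n → Fin n) k {v x} → iterate h v k ≡ x →
                          FirstHit h k v x ⊎ Visits h k (h x) x
iterate⇒FirstHit⊎cyclic h zero    eq = inj₁ eq
iterate⇒FirstHit⊎cyclic h (suc k) {v} {x} eq with v ≟ᶠ x
... | yes refl = inj₂ (Visits-suc h k (iterate⇒Visits h k eq))
... | no v≢x with iterate⇒FirstHit⊎cyclic h k eq
...   | inj₁ hit   = inj₁ (v≢x , hit)
...   | inj₂ cycle = inj₂ (Visits-suc h k cycle)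

-- The last point `w` before `y` is itself hit for the first time: an earlier visit to `w` would
-- bring the orbit to `y` too early.
FirstHit-last : ∀ (h : Fin n → Fin n) j {v y} → FirstHit h (suc j) v y →
                ∃ λ w → FirstHit h j v w × h w ≡ y
FirstHit-last h zero    {v} (_ , hv≡y) = v , refl , hv≡y
FirstHit-last h (suc j) (_ , hit@(hv≢y , _)) with FirstHit-last h j hit
... | w , hit′ , hw≡y = w , ((λ { refl → hv≢y hw≡y }) , hit′) , hw≡y

∑-visits : ∀ (h : Fin n → Fin n) j v → ∑[ y ∈ allFin n ] ⟦ visits? h j v y ⟧ ≤ suc j
∑-visits h zero    v = ≤-reflexive (∑-point₁ v)
∑-visits {n} h (suc j) v = begin
  ∑[ y ∈ allFin n ] ⟦ visits? h (suc j) v y ⟧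
    ≤⟨ ∑-mono (allFin n) (λ y → ⟦⟧-⊎ (v ≟ᶠ y) (visits? h j (h v) y)) ⟩
  ∑[ y ∈ allFin n ] (⟦ v ≟ᶠ y ⟧ + ⟦ visits? h j (h v) y ⟧)
    ≡⟨ ∑-distrib-+ (allFin n) _ _ ⟩
  (∑[ y ∈ allFin n ] ⟦ v ≟ᶠ y ⟧) + (∑[ y ∈ allFin n ] ⟦ visits? h j (h v) y ⟧)
    ≤⟨ +-mono-≤ (≤-reflexive (∑-point₁ v)) (∑-visits h j (h v)) ⟩
  suc (suc j)
    ∎
  where open ≤-Reasoning

module _ {h h′ : Fin n → Fin n} {x : Fin n} (agree : ∀ {v} → v ≢ x → h v ≡ h′ v) where

  -- An orbit stopped on its first arrival at `x` never applies the map at `x`.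
  FirstHit-agree : ∀ j {v} → FirstHit h j v x → FirstHit h′ j v x
  FirstHit-agree zero    v≡x         = v≡x
  FirstHit-agree (suc j) (v≢x , hit) =
    v≢x , subst (λ w → FirstHit h′ j w x) (agree v≢x) (FirstHit-agree j hit)

  -- A visit that passes through `x` earlier can be replaced by that earlier arrival, before which
  -- the two maps agree.
  Visits-agree : ∀ j {v} → Visits h j v x → Visits h′ j v x
  Visits-agree zero    v≡x          = v≡x
  Visits-agree (suc j) (inj₁ v≡x)   = inj₁ v≡x
  Visits-agree (suc j) {v} (inj₂ visit) with v ≟ᶠ x
  ... | yes v≡x = inj₁ v≡x
  ... | no  v≢x = inj₂ (subst (λ w → Visits h′ j w x) (agree v≢x) (Visits-agree j visit))

  -- Either the orbit meets `x` before `y`, and then `y` follows `h x` within `j` steps, or the path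
  -- to `y` never uses the value at `x` and survives unchanged under `h′`, together with its last
  -- point `w` before `y`.
  FirstHit-avoids⊎Visits : ∀ j {v y} → FirstHit h (suc j) v y →
    Visits h j (h x) y ⊎ ∃ λ w → w ≢ x × FirstHit h′ j v w × h′ w ≡ y
  FirstHit-avoids⊎Visits j {v} hit with v ≟ᶠ x
  FirstHit-avoids⊎Visits j (_ , hit) | yes refl = inj₁ (FirstHit⇒Visits h j hit)
  FirstHit-avoids⊎Visits zero {v} (_ , hv≡y) | no v≢x =
    inj₂ (v , v≢x , refl , trans (sym (agree v≢x)) hv≡y)
  FirstHit-avoids⊎Visits (suc j) {v} (_ , hit@(hv≢y , _)) | no v≢x
    with FirstHit-avoids⊎Visits j hit
  ... | inj₁ visit = inj₁ (Visits-suc h j visit)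
  ... | inj₂ (w , w≢x , hit′ , h′w≡y) = inj₂
    (w , w≢x , (v≢w , subst (λ u → FirstHit h′ j u w) (agree v≢x) hit′) , h′w≡y)
    where
    v≢w : v ≢ w
    v≢w refl = hv≢y (trans (agree v≢x) h′w≡y)

-- Collisions of a map on a subset.

module Collisions {T : Fin n → Set} (T? : ∀ x → Dec (T x)) (h : Fin n → Fin n) where

  Redundant Image : Fin n → Set
  Redundant x = T x × ∃ λ x′ → x′ ≢ x × T x′ × h x′ ≡ h x
  Image y     = ∃ λ x → T x × h x ≡ y

  redundant? : ∀ x → Dec (Redundant x)
  redundant? x = T? x ×-dec any? λ x′ → ¬? (x′ ≟ᶠ x) ×-dec T? x′ ×-dec h x′ ≟ᶠ h x

  image? : ∀ y → Dec (Image y)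
  image? y = any? λ x → T? x ×-dec h x ≟ᶠ y

  -- The inequality holds on each fibre. With N ≥ 2 points of `T` all of them are redundant, and N +
  -- 2 ≤ 2 N; with N ≤ 1 none is, and the image indicator is at most N.
  ∑-redundant : (∑[ x ∈ allFin n ] ⟦ redundant? x ⟧) + 2 * (∑[ y ∈ allFin n ] ⟦ image? y ⟧)
                ≤ 2 * (∑[ x ∈ allFin n ] ⟦ T? x ⟧)
  ∑-redundant = begin
    (∑[ x ∈ allFin n ] ⟦ redundant? x ⟧) + 2 * (∑[ y ∈ allFin n ] ⟦ image? y ⟧)
      ≡⟨ cong₂ _+_ (∑-fibres (allFin n) h λ x _ → ⟦ redundant? x ⟧)
                   (sym (∑-distribˡ-* 2 (allFin n) λ y → ⟦ image? y ⟧)) ⟩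
    (∑[ y ∈ allFin n ] R y) + (∑[ y ∈ allFin n ] 2 * ⟦ image? y ⟧)
      ≡⟨ ∑-distrib-+ (allFin n) R _ ⟨
    ∑[ y ∈ allFin n ] (R y + 2 * ⟦ image? y ⟧)
      ≤⟨ ∑-mono (allFin n) fibrewise ⟩
    ∑[ y ∈ allFin n ] 2 * N y
      ≡⟨ ∑-distribˡ-* 2 (allFin n) N ⟩
    2 * (∑[ y ∈ allFin n ] N y)
      ≡⟨ cong (2 *_) (∑-fibres (allFin n) h λ x _ → ⟦ T? x ⟧) ⟨
    2 * (∑[ x ∈ allFin n ] ⟦ T? x ⟧)
      ∎
    where
    open ≤-Reasoning
    R N : Fin n → ℕ
    R y = ∑[ x ∈ allFin n ] ⟦ h x ≟ᶠ y ⟧ * ⟦ redundant? x ⟧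
    N y = ∑[ x ∈ allFin n ] ⟦ h x ≟ᶠ y ⟧ * ⟦ T? x ⟧

    N-count : ∀ y → ∑[ x ∈ allFin n ] ⟦ h x ≟ᶠ y ×-dec T? x ⟧ ≡ N y
    N-count y = ∑-cong (allFin n) λ x → ⟦⟧-× (h x ≟ᶠ y) (T? x)

    R≤N : ∀ y → R y ≤ N y
    R≤N y = ∑-mono (allFin n) λ x → *-monoʳ-≤ ⟦ h x ≟ᶠ y ⟧ (⟦⟧-mono (redundant? x) (T? x) proj₁)

    fibrewise : ∀ y → R y + 2 * ⟦ image? y ⟧ ≤ 2 * N y
    fibrewise y with any? (λ x → h x ≟ᶠ y ×-dec redundant? x)
    ... | yes (x , refl , Tx , x′ , x′≢x , Tx′ , eq) = begin
      R y + 2 * ⟦ image? y ⟧   ≤⟨ +-mono-≤ (R≤N y) (*-monoʳ-≤ 2 (⟦⟧≤1 (image? y))) ⟩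
      N y + 2                  ≤⟨ +-monoʳ-≤ (N y) 2≤N ⟩
      N y + N y                ≡⟨ cong (N y +_) (+-identityʳ (N y)) ⟨
      2 * N y                  ∎
      where
      2≤N : 2 ≤ N y
      2≤N = ≤-trans (∑-two (λ x → h x ≟ᶠ y ×-dec T? x) x′≢x (refl , Tx) (eq , Tx′))
              (≤-reflexive (N-count y))
    ... | no none = ≤-trans (≤-reflexive (cong (_+ 2 * ⟦ image? y ⟧) R≡0)) (*-monoʳ-≤ 2 image≤N)
      where
      R≡0 : R y ≡ 0
      R≡0 = trans
        (∑-cong (allFin n) λ x → trans (sym (⟦⟧-× (h x ≟ᶠ y) (redundant? x)))
          (⟦⟧-no (h x ≟ᶠ y ×-dec redundant? x) λ r → none (x , r)))
        (trans (∑-allFin-const n 0) (*-zeroʳ n))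
      image≤N : ⟦ image? y ⟧ ≤ N y
      image≤N with image? y
      ... | no _              = z≤n
      ... | yes (x , Tx , eq) =
        ≤-trans (∑-pos (λ x → h x ≟ᶠ y ×-dec T? x) (eq , Tx)) (≤-reflexive (N-count y))

-- The random map φ ∘ g

2ab≤a²+b² : ∀ p q → 2 * (p * q) ≤ p * p + q * q
2ab≤a²+b² p q with ≤-total p q
... | inj₁ p≤q = ordered p≤q
  where
  ordered : ∀ {p q} → p ≤ q → 2 * (p * q) ≤ p * p + q * q
  ordered {p} {q} p≤q rewrite sym (m+[n∸m]≡n p≤q) =
    ≤-trans (m≤m+n _ ((q ∸ p) * (q ∸ p))) (≤-reflexive (expand p (q ∸ p)))
    where
    expand : ∀ p d → 2 * (p * (p + d)) + d * d ≡ p * p + (p + d) * (p + d)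
    expand = solve-∀
... | inj₂ q≤p rewrite sym (m+[n∸m]≡n q≤p) =
    ≤-trans (m≤m+n _ ((p ∸ q) * (p ∸ q))) (≤-reflexive (expand q (p ∸ q)))
    where
    expand : ∀ q d → 2 * ((q + d) * q) + d * d ≡ (q + d) * (q + d) + q * q
    expand = solve-∀

module RandomMap {n} .{{_ : NonZero n}} (φ : Fin n → Fin n) where

  step : (Fin n → Fin n) → Fin n → Fin n
  step g x = φ (g x)

  maps : List (Fin n → Fin n)
  maps = functions n n

  T : (Fin n → Fin n) → ℕ → Fin n → Set
  T g j x = ∃ λ u → FirstHit (step g) j (φ u) x

  T? : ∀ g j x → Dec (T g j x)
  T? g j x = any? λ u → firstHit? (step g) j (φ u) x

  imageφ? : ∀ y → Dec (∃ λ u → φ u ≡ y)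
  imageφ? y = any? λ u → φ u ≟ᶠ y

  -- Expectations over `g` are kept as integer sums over `maps`, and `G` is the normalising factor,
  -- which appears on the other side of the estimates.
  M G : ℕ
  M = ∑[ y ∈ allFin n ] ⟦ imageφ? y ⟧
  G = length maps

  fibre : Fin n → ℕ
  fibre y = ∑[ z ∈ allFin n ] ⟦ φ z ≟ᶠ y ⟧

  size : ℕ → (Fin n → Fin n) → ℕ
  size j g = ∑[ x ∈ allFin n ] ⟦ T? g j x ⟧

  M≢0 : NonZero M
  M≢0 = >-nonZero (∑-pos imageφ? (y₀ , refl))
    where
    y₀ : Fin n
    y₀ = fromℕ< {0} (>-nonZero⁻¹ n)

  step-agree : ∀ g x z {v} → v ≢ x → step g v ≡ step (g [ x ↦ z ]) v
  step-agree g x z v≢x = cong φ (sym ([↦]-minimal g x z v≢x))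

  step-agree⁻¹ : ∀ g x z {v} → v ≢ x → step (g [ x ↦ z ]) v ≡ step g v
  step-agree⁻¹ g x z v≢x = sym (step-agree g x z v≢x)

  T-[↦] : ∀ g x z j → T g j x → T (g [ x ↦ z ]) j x
  T-[↦] g x z j (u , hit) = u , FirstHit-agree (step-agree g x z) j hit

  T-[↦]⁻¹ : ∀ g x z j → T (g [ x ↦ z ]) j x → T g j x
  T-[↦]⁻¹ g x z j (u , hit) = u , FirstHit-agree (step-agree⁻¹ g x z) j hit

  -- Without its first step the orbit starts at `step g (φ u)`, again a point of the image of `φ`.
  T-suc : ∀ g j {x} → T g (suc j) x → T g j x
  T-suc g j (u , _ , hit) = g (φ u) , hit

  T-preimage : ∀ g j {y} → T g (suc j) y → ∃ λ x → T g j x × step g x ≡ y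
  T-preimage g j (u , hit) with FirstHit-last (step g) j hit
  ... | x , hit′ , eq = x , (u , hit′) , eq

  module C g j = Collisions (T? g j) (step g)

  -- The path that first reaches `φ z` at time `j + 1` avoids `x`, since otherwise `φ z` would lie
  -- on the orbit of `step g x`. Its last point `w` before `φ z` therefore stays in T_j after the
  -- change, and `x` now shares its image with `w`.
  redirect-redundant : ∀ g j x z → T g j x → T g (suc j) (φ z) →
    ¬ Visits (step g) j (step g x) (φ z) → C.Redundant (g [ x ↦ z ]) j x
  redirect-redundant g j x z Tx (u , hit) ¬visit
    with FirstHit-avoids⊎Visits (step-agree g x z) j hit
  ... | inj₁ visit = ⊥-elim (¬visit visit)
  ... | inj₂ (w , w≢x , hit′ , eq) = T-[↦] g x z j Tx , w , w≢x , (u , hit′) ,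
        trans eq (cong φ (sym ([↦]-updates g x z)))

  -- The ratio of `fibre y` to `n` is the probability that `step g x` equals `y`. Heavy points have
  -- probability at least 1 / (4 M), a quarter of the average over the image of `φ`.
  Heavy Light : Fin n → Set
  Heavy y = n ≤ 4 * (M * fibre y)
  Light y = ¬ Heavy y

  heavy? : ∀ y → Dec (Heavy y)
  heavy? y = n ≤? 4 * (M * fibre y)

  light? : ∀ y → Dec (Light y)
  light? y = ¬? (heavy? y)

  -- The `suc j` subtracted in `gain` bounds the number of points on the orbit of `step g x`, which
  -- are excluded as targets of a redirection. A negative difference counts as zero.
  heavySize lightSize redundancy gain : ℕ → (Fin n → Fin n) → ℕ
  heavySize j g  = ∑[ y ∈ allFin n ] ⟦ heavy? y ×-dec T? g j y ⟧
  lightSize j g  = ∑[ y ∈ allFin n ] ⟦ light? y ×-dec T? g j y ⟧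
  redundancy j g = ∑[ x ∈ allFin n ] ⟦ C.redundant? g j x ⟧
  gain j g       = heavySize (suc j) g ∸ suc j

  ∑-fibre : ∀ (F : Fin n → ℕ) → ∑[ z ∈ allFin n ] F (φ z) ≡ ∑[ y ∈ allFin n ] fibre y * F y
  ∑-fibre F = trans (∑-fibres (allFin n) φ λ _ y → F y)
    (∑-cong (allFin n) λ y → ∑-distribʳ-* (F y) (allFin n) λ z → ⟦ φ z ≟ᶠ y ⟧)

  size-split : ∀ j g → size j g ≡ heavySize j g + lightSize j g
  size-split j g = trans (∑-cong (allFin n) λ y → split (heavy? y) (T? g j y))
    (∑-distrib-+ (allFin n) _ _)
    where
    split : ∀ {P Q : Set} (P? : Dec P) (Q? : Dec Q) →
            ⟦ Q? ⟧ ≡ ⟦ P? ×-dec Q? ⟧ + ⟦ ¬? P? ×-dec Q? ⟧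
    split (yes _) (yes _) = refl
    split (yes _) (no _)  = refl
    split (no _)  (yes _) = refl
    split (no _)  (no _)  = refl

  redundancy-bound : ∀ j g → redundancy j g + 2 * size (suc j) g ≤ 2 * size j g
  redundancy-bound j g = ≤-trans
    (+-monoʳ-≤ (redundancy j g) (*-monoʳ-≤ 2
      (∑-mono (allFin n) λ y → ⟦⟧-mono (T? g (suc j) y) (C.image? g j y) (T-preimage g j))))
    (C.∑-redundant g j)

  gain≤size : ∀ j g → gain j g ≤ size j g
  gain≤size j g = ≤-trans (m∸n≤m (heavySize (suc j) g) (suc j))
    (∑-mono (allFin n) λ y → ⟦⟧-mono (heavy? y ×-dec T? g (suc j) y) (T? g j y)
      λ (_ , Ty) → T-suc g j Ty)

  -- Each heavy point of T_{j+1} off the orbit of `step g x` equals `φ z` for at least n / (4 M)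
  -- values `z`, and every such value makes `x` redundant.
  n*gain≤redirections : ∀ j g x → T g j x →
    n * gain j g ≤ 4 * (M * (∑[ z ∈ allFin n ] ⟦ C.redundant? (g [ x ↦ z ]) j x ⟧))
  n*gain≤redirections j g x Tx = begin
    n * (heavySize (suc j) g ∸ suc j)
      ≡⟨ *-distribˡ-∸ n (heavySize (suc j) g) (suc j) ⟩
    n * heavySize (suc j) g ∸ n * suc j
      ≤⟨ m≤n+o⇒m∸n≤o (n * heavySize (suc j) g) (n * suc j) total ⟩
    4 * (M * (∑[ z ∈ allFin n ] ⟦ C.redundant? (g [ x ↦ z ]) j x ⟧))
      ∎
    where
    open ≤-Reasoning
    onPath? : ∀ y → Dec (Visits (step g) j (step g x) y)
    onPath? = visits? (step g) j (step g x)
    free? : ∀ y → Dec (T g (suc j) y × ¬ Visits (step g) j (step g x) y)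
    free? y = T? g (suc j) y ×-dec ¬? (onPath? y)

    pointwise : ∀ y → n * ⟦ heavy? y ×-dec T? g (suc j) y ⟧ ≤
                      n * ⟦ onPath? y ⟧ + 4 * (M * (fibre y * ⟦ free? y ⟧))
    pointwise y with heavy? y | T? g (suc j) y | onPath? y
    ... | no _  | _     | _     = ≤-trans (≤-reflexive (*-zeroʳ n)) z≤n
    ... | yes _ | no _  | _     = ≤-trans (≤-reflexive (*-zeroʳ n)) z≤n
    ... | yes _ | yes _ | yes _ = m≤m+n (n * 1) _
    ... | yes heavy | yes _ | no _ = begin
      n * 1                             ≡⟨ *-identityʳ n ⟩
      n                                 ≤⟨ heavy ⟩
      4 * (M * fibre y)                 ≡⟨ cong (λ c → 4 * (M * c)) (*-identityʳ (fibre y)) ⟨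
      4 * (M * (fibre y * 1))           ≤⟨ m≤n+m _ (n * 0) ⟩
      n * 0 + 4 * (M * (fibre y * 1))   ∎

    total : n * heavySize (suc j) g ≤
            n * suc j + 4 * (M * (∑[ z ∈ allFin n ] ⟦ C.redundant? (g [ x ↦ z ]) j x ⟧))
    total = begin
      n * heavySize (suc j) g
        ≡⟨ ∑-distribˡ-* n (allFin n) _ ⟨
      ∑[ y ∈ allFin n ] n * ⟦ heavy? y ×-dec T? g (suc j) y ⟧
        ≤⟨ ∑-mono (allFin n) pointwise ⟩
      ∑[ y ∈ allFin n ] (n * ⟦ onPath? y ⟧ + 4 * (M * (fibre y * ⟦ free? y ⟧)))
        ≡⟨ ∑-distrib-+ (allFin n) _ _ ⟩
      (∑[ y ∈ allFin n ] n * ⟦ onPath? y ⟧) + (∑[ y ∈ allFin n ] 4 * (M * (fibre y * ⟦ free? y ⟧)))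
        ≡⟨ cong₂ _+_ (∑-distribˡ-* n (allFin n) _)
             (trans (∑-distribˡ-* 4 (allFin n) _) (cong (4 *_) (∑-distribˡ-* M (allFin n) _))) ⟩
      n * (∑[ y ∈ allFin n ] ⟦ onPath? y ⟧) + 4 * (M * (∑[ y ∈ allFin n ] fibre y * ⟦ free? y ⟧))
        ≡⟨ cong (λ s → n * (∑[ y ∈ allFin n ] ⟦ onPath? y ⟧) + 4 * (M * s)) (∑-fibre λ y → ⟦ free? y ⟧) ⟨
      n * (∑[ y ∈ allFin n ] ⟦ onPath? y ⟧) + 4 * (M * (∑[ z ∈ allFin n ] ⟦ free? (φ z) ⟧))
        ≤⟨ +-mono-≤ (*-monoʳ-≤ n (∑-visits (step g) j (step g x)))
             (*-monoʳ-≤ 4 (*-monoʳ-≤ M (∑-mono (allFin n) λ z →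
               ⟦⟧-mono (free? (φ z)) (C.redundant? (g [ x ↦ z ]) j x)
                 λ (Ty , ¬visit) → redirect-redundant g j x z Tx Ty ¬visit))) ⟩
      n * suc j + 4 * (M * (∑[ z ∈ allFin n ] ⟦ C.redundant? (g [ x ↦ z ]) j x ⟧))
        ∎

  -- One factor `gain` is at most the number of points `x` in T_j that can be redirected; the other
  -- is paid for by the successful values `z` at each such `x`. Resampling turns the sum over `g`,
  -- `x` and `z` back into the redundancy of a random map.
  gain²≤redundancy : ∀ j → ∑[ g ∈ maps ] gain j g * gain j g ≤ 4 * (M * ∑ maps (redundancy j))
  gain²≤redundancy j = *-cancelˡ-≤ n (begin
    n * (∑[ g ∈ maps ] gain j g * gain j g)
      ≡⟨ ∑-distribˡ-* n maps _ ⟨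
    ∑[ g ∈ maps ] n * (gain j g * gain j g)
      ≤⟨ ∑-mono maps pathwise ⟩
    ∑[ g ∈ maps ] 4 * (M * (∑[ x ∈ allFin n ] ∑[ z ∈ allFin n ] R x (g [ x ↦ z ])))
      ≡⟨ trans (∑-distribˡ-* 4 maps _) (cong (4 *_) (∑-distribˡ-* M maps _)) ⟩
    4 * (M * (∑[ g ∈ maps ] ∑[ x ∈ allFin n ] ∑[ z ∈ allFin n ] R x (g [ x ↦ z ])))
      ≡⟨ cong (λ s → 4 * (M * s)) resampled ⟩
    4 * (M * (n * ∑ maps (redundancy j)))
      ≡⟨ rearrange M n (∑ maps (redundancy j)) ⟩
    n * (4 * (M * ∑ maps (redundancy j)))
      ∎)
    where
    open ≤-Reasoning
    R : Fin n → (Fin n → Fin n) → ℕ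
    R x g = ⟦ C.redundant? g j x ⟧

    rearrange : ∀ p q r → 4 * (p * (q * r)) ≡ q * (4 * (p * r))
    rearrange = solve-∀

    resampled : ∑[ g ∈ maps ] ∑[ x ∈ allFin n ] ∑[ z ∈ allFin n ] R x (g [ x ↦ z ]) ≡
                n * ∑ maps (redundancy j)
    resampled = begin-equality
      ∑[ g ∈ maps ] ∑[ x ∈ allFin n ] ∑[ z ∈ allFin n ] R x (g [ x ↦ z ])
        ≡⟨ ∑-swap maps (allFin n) _ ⟩
      ∑[ x ∈ allFin n ] ∑[ g ∈ maps ] ∑[ z ∈ allFin n ] R x (g [ x ↦ z ])
        ≡⟨ ∑-cong (allFin n) (λ x → ∑-resample x (R x)) ⟩
      ∑[ x ∈ allFin n ] n * ∑ maps (R x)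
        ≡⟨ ∑-distribˡ-* n (allFin n) _ ⟩
      n * (∑[ x ∈ allFin n ] ∑ maps (R x))
        ≡⟨ cong (n *_) (∑-swap (allFin n) maps R) ⟩
      n * ∑ maps (redundancy j)
        ∎

    pathwise : ∀ g → n * (gain j g * gain j g) ≤
                     4 * (M * (∑[ x ∈ allFin n ] ∑[ z ∈ allFin n ] R x (g [ x ↦ z ])))
    pathwise g = begin
      n * (gain j g * gain j g)
        ≤⟨ *-monoʳ-≤ n (*-monoˡ-≤ (gain j g) (gain≤size j g)) ⟩
      n * (size j g * gain j g)
        ≡⟨ shuffle n (size j g) (gain j g) ⟩
      size j g * (n * gain j g)
        ≡⟨ ∑-distribʳ-* (n * gain j g) (allFin n) (λ x → ⟦ T? g j x ⟧) ⟨
      ∑[ x ∈ allFin n ] ⟦ T? g j x ⟧ * (n * gain j g)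
        ≤⟨ ∑-mono (allFin n) pointwise ⟩
      ∑[ x ∈ allFin n ] 4 * (M * (∑[ z ∈ allFin n ] R x (g [ x ↦ z ])))
        ≡⟨ trans (∑-distribˡ-* 4 (allFin n) _) (cong (4 *_) (∑-distribˡ-* M (allFin n) _)) ⟩
      4 * (M * (∑[ x ∈ allFin n ] ∑[ z ∈ allFin n ] R x (g [ x ↦ z ])))
        ∎
      where
      shuffle : ∀ p q r → p * (q * r) ≡ q * (p * r)
      shuffle = solve-∀
      pointwise : ∀ x → ⟦ T? g j x ⟧ * (n * gain j g) ≤
                        4 * (M * (∑[ z ∈ allFin n ] R x (g [ x ↦ z ])))
      pointwise x with T? g j x
      ... | no _   = z≤n
      ... | yes Tx = ≤-trans (≤-reflexive (*-identityˡ _)) (n*gain≤redirections j g x Tx)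

  -- Only the M points of the image of `φ` have nonempty fibres, and a light one has fewer than n /
  -- (4 M) preimages.
  4*∑-light≤n : 4 * (∑[ z ∈ allFin n ] ⟦ light? (φ z) ⟧) ≤ n
  4*∑-light≤n = *-cancelˡ-≤ M {{M≢0}} (begin
    M * (4 * (∑[ z ∈ allFin n ] ⟦ light? (φ z) ⟧))
      ≡⟨ cong (λ s → M * (4 * s)) (∑-fibre λ y → ⟦ light? y ⟧) ⟩
    M * (4 * (∑[ y ∈ allFin n ] fibre y * ⟦ light? y ⟧))
      ≡⟨ trans (∑-distribˡ-* M (allFin n) _) (cong (M *_) (∑-distribˡ-* 4 (allFin n) _)) ⟨
    ∑[ y ∈ allFin n ] M * (4 * (fibre y * ⟦ light? y ⟧))
      ≤⟨ ∑-mono (allFin n) pointwise ⟩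
    ∑[ y ∈ allFin n ] ⟦ imageφ? y ⟧ * n
      ≡⟨ ∑-distribʳ-* n (allFin n) _ ⟩
    M * n
      ∎)
    where
    open ≤-Reasoning
    rearrange : ∀ p q → p * (4 * (q * 1)) ≡ 4 * (p * q)
    rearrange = solve-∀
    fibre≡0 : ∀ y → ¬ (∃ λ u → φ u ≡ y) → fibre y ≡ 0
    fibre≡0 y ¬image = trans (∑-cong (allFin n) λ z → ⟦⟧-no (φ z ≟ᶠ y) λ eq → ¬image (z , eq))
      (trans (∑-allFin-const n 0) (*-zeroʳ n))
    pointwise : ∀ y → M * (4 * (fibre y * ⟦ light? y ⟧)) ≤ ⟦ imageφ? y ⟧ * n
    pointwise y with heavy? y | imageφ? y
    ... | yes _  | _     = ≤-trans (≤-reflexive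
            (trans (cong (λ s → M * (4 * s)) (*-zeroʳ (fibre y))) (*-zeroʳ M))) z≤n
    ... | no light | yes _ = ≤-trans (≤-reflexive (rearrange M (fibre y)))
            (≤-trans (<⇒≤ (≰⇒> light)) (≤-reflexive (sym (*-identityˡ n))))
    ... | no _   | no ¬image = ≤-reflexive
            (trans (cong (λ c → M * (4 * (c * 1))) (fibre≡0 y ¬image)) (*-zeroʳ M))

  -- Every light point of T_{j+1} is the image of some `x` in T_j. Membership of `x` in T_j is
  -- independent of `g x`, so `x` is sent to a light point with conditional probability at most 1/4.
  4*lightSize≤size : ∀ j → 4 * ∑ maps (lightSize (suc j)) ≤ ∑ maps (size j)
  4*lightSize≤size j = *-cancelˡ-≤ n (begin
    n * (4 * ∑ maps (lightSize (suc j)))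
      ≤⟨ *-monoʳ-≤ n (*-monoʳ-≤ 4 (∑-mono maps preimages)) ⟩
    n * (4 * (∑[ g ∈ maps ] ∑[ x ∈ allFin n ] L x g))
      ≡⟨ cong (λ s → n * (4 * s)) (∑-swap maps (allFin n) _) ⟩
    n * (4 * (∑[ x ∈ allFin n ] ∑ maps (L x)))
      ≡⟨ rearrange n _ ⟩
    4 * (n * (∑[ x ∈ allFin n ] ∑ maps (L x)))
      ≡⟨ cong (4 *_) (∑-distribˡ-* n (allFin n) _) ⟨
    4 * (∑[ x ∈ allFin n ] n * ∑ maps (L x))
      ≡⟨ cong (4 *_) (∑-cong (allFin n) λ x → ∑-resample x (L x)) ⟨
    4 * (∑[ x ∈ allFin n ] ∑[ g ∈ maps ] ∑[ z ∈ allFin n ] L x (g [ x ↦ z ]))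
      ≡⟨ cong (4 *_) (∑-cong (allFin n) λ x → ∑-cong maps λ g → trans
           (∑-cong (allFin n) (independent x g)) (∑-distribˡ-* ⟦ T? g j x ⟧ (allFin n) _)) ⟩
    4 * (∑[ x ∈ allFin n ] ∑[ g ∈ maps ] ⟦ T? g j x ⟧ * lightCount)
      ≡⟨ cong (4 *_) (∑-swap (allFin n) maps _) ⟩
    4 * (∑[ g ∈ maps ] ∑[ x ∈ allFin n ] ⟦ T? g j x ⟧ * lightCount)
      ≡⟨ cong (4 *_) (trans (∑-cong maps λ g → ∑-distribʳ-* lightCount (allFin n) λ x → ⟦ T? g j x ⟧)
           (∑-distribʳ-* lightCount maps (size j))) ⟩
    4 * (∑ maps (size j) * lightCount)
      ≡⟨ rearrange′ (∑ maps (size j)) lightCount ⟩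
    4 * lightCount * ∑ maps (size j)
      ≤⟨ *-monoˡ-≤ (∑ maps (size j)) 4*∑-light≤n ⟩
    n * ∑ maps (size j)
      ∎)
    where
    open ≤-Reasoning
    lightCount : ℕ
    lightCount = ∑[ z ∈ allFin n ] ⟦ light? (φ z) ⟧

    L : Fin n → (Fin n → Fin n) → ℕ
    L x g = ⟦ T? g j x ⟧ * ⟦ light? (step g x) ⟧

    rearrange : ∀ p q → p * (4 * q) ≡ 4 * (p * q)
    rearrange = solve-∀
    rearrange′ : ∀ p q → 4 * (p * q) ≡ 4 * q * p
    rearrange′ = solve-∀

    independent : ∀ x g z → L x (g [ x ↦ z ]) ≡ ⟦ T? g j x ⟧ * ⟦ light? (φ z) ⟧
    independent x g z = cong₂ _*_
      (⟦⟧-cong (T? (g [ x ↦ z ]) j x) (T? g j x) (T-[↦]⁻¹ g x z j) (T-[↦] g x z j))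
      (cong (λ y → ⟦ light? (φ y) ⟧) ([↦]-updates g x z))

    preimages : ∀ g → lightSize (suc j) g ≤ ∑[ x ∈ allFin n ] L x g
    preimages g = begin
      lightSize (suc j) g
        ≤⟨ ∑-mono (allFin n) pointwise ⟩
      ∑[ y ∈ allFin n ] ∑[ x ∈ allFin n ] ⟦ step g x ≟ᶠ y ⟧ * (⟦ T? g j x ⟧ * ⟦ light? y ⟧)
        ≡⟨ ∑-fibres (allFin n) (step g) (λ x y → ⟦ T? g j x ⟧ * ⟦ light? y ⟧) ⟨
      ∑[ x ∈ allFin n ] L x g
        ∎
      where
      pointwise : ∀ y → ⟦ light? y ×-dec T? g (suc j) y ⟧ ≤
                        ∑[ x ∈ allFin n ] ⟦ step g x ≟ᶠ y ⟧ * (⟦ T? g j x ⟧ * ⟦ light? y ⟧)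
      pointwise y with light? y ×-dec T? g (suc j) y
      ... | no _ = z≤n
      ... | yes (light , Ty) with T-preimage g j Ty
      ...   | x₀ , Tx₀ , eq = ≤-trans
              (∑-pos (λ x → step g x ≟ᶠ y ×-dec (T? g j x ×-dec light? y)) (eq , Tx₀ , light))
              (≤-reflexive (∑-cong (allFin n) λ x →
                trans (⟦⟧-× (step g x ≟ᶠ y) (T? g j x ×-dec light? y))
                  (cong (⟦ step g x ≟ᶠ y ⟧ *_) (⟦⟧-× (T? g j x) (light? y)))))

  -- AM-GM 2 (J x) (16 M) ≤ (J x)² + (16 M)² is nearly tight at the size x ≈ 16 M / J
  -- that the recurrence predicts for iterate J.
  gain≤redundancy : ∀ j → let J = suc j in
    8 * (J * ∑ maps (gain j)) ≤ J * J * ∑ maps (redundancy j) + 64 * (M * G)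
  gain≤redundancy j = *-cancelˡ-≤ (4 * M) {{m*n≢0 4 M {{_}} {{M≢0}}}} (begin
    4 * M * (8 * (J * W))
      ≡⟨ eq₁ M J W ⟩
    32 * (M * J) * W
      ≡⟨ ∑-distribˡ-* (32 * (M * J)) maps (gain j) ⟨
    ∑[ g ∈ maps ] 32 * (M * J) * gain j g
      ≤⟨ ∑-mono maps pathwise ⟩
    ∑[ g ∈ maps ] (J * J * (gain j g * gain j g) + 256 * (M * M))
      ≡⟨ ∑-distrib-+ maps _ _ ⟩
    (∑[ g ∈ maps ] J * J * (gain j g * gain j g)) + (∑[ g ∈ maps ] 256 * (M * M))
      ≡⟨ cong₂ _+_ (∑-distribˡ-* (J * J) maps _) (∑-const maps (256 * (M * M))) ⟩
    J * J * (∑[ g ∈ maps ] gain j g * gain j g) + G * (256 * (M * M))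
      ≤⟨ +-monoˡ-≤ _ (*-monoʳ-≤ (J * J) (gain²≤redundancy j)) ⟩
    J * J * (4 * (M * R)) + G * (256 * (M * M))
      ≡⟨ eq₂ M J R G ⟩
    4 * M * (J * J * R + 64 * (M * G))
      ∎)
    where
    open ≤-Reasoning
    J W R : ℕ
    J = suc j
    W = ∑ maps (gain j)
    R = ∑ maps (redundancy j)

    eq₁ : ∀ M J W → 4 * M * (8 * (J * W)) ≡ 32 * (M * J) * W
    eq₁ = solve-∀
    eq₂ : ∀ M J R G → J * J * (4 * (M * R)) + G * (256 * (M * M)) ≡ 4 * M * (J * J * R + 64 * (M * G))
    eq₂ = solve-∀
    eq₃ : ∀ M J x → 32 * (M * J) * x ≡ 2 * (J * x * (16 * M))
    eq₃ = solve-∀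
    eq₄ : ∀ M J x → J * x * (J * x) + 16 * M * (16 * M) ≡ J * J * (x * x) + 256 * (M * M)
    eq₄ = solve-∀

    pathwise : ∀ g → 32 * (M * J) * gain j g ≤ J * J * (gain j g * gain j g) + 256 * (M * M)
    pathwise g = begin
      32 * (M * J) * gain j g                                 ≡⟨ eq₃ M J (gain j g) ⟩
      2 * (J * gain j g * (16 * M))                           ≤⟨ 2ab≤a²+b² (J * gain j g) (16 * M) ⟩
      J * gain j g * (J * gain j g) + 16 * M * (16 * M)       ≡⟨ eq₄ M J (gain j g) ⟩
      J * J * (gain j g * gain j g) + 256 * (M * M)           ∎

  size≤gain+light : ∀ j →
    ∑ maps (size (suc j)) ≤ ∑ maps (gain j) + suc j * G + ∑ maps (lightSize (suc j))
  size≤gain+light j = begin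
    ∑ maps (size (suc j))
      ≤⟨ ∑-mono maps pathwise ⟩
    ∑[ g ∈ maps ] (gain j g + suc j + lightSize (suc j) g)
      ≡⟨ trans (∑-distrib-+ maps _ _) (cong (_+ ∑ maps (lightSize (suc j)))
           (trans (∑-distrib-+ maps (gain j) (const (suc j)))
             (cong (∑ maps (gain j) +_) (trans (∑-const maps (suc j)) (*-comm G (suc j)))))) ⟩
    ∑ maps (gain j) + suc j * G + ∑ maps (lightSize (suc j))
      ∎
    where
    open ≤-Reasoning
    pathwise : ∀ g → size (suc j) g ≤ gain j g + suc j + lightSize (suc j) g
    pathwise g = begin
      size (suc j) g                                  ≡⟨ size-split (suc j) g ⟩
      heavySize (suc j) g + lightSize (suc j) g       ≤⟨ +-monoˡ-≤ _ (m≤n+m∸n (heavySize (suc j) g) (suc j)) ⟩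
      suc j + gain j g + lightSize (suc j) g          ≡⟨ cong (_+ lightSize (suc j) g) (+-comm (suc j) (gain j g)) ⟩
      gain j g + suc j + lightSize (suc j) g          ∎

  ∑-redundancy-bound : ∀ j →
    ∑ maps (redundancy j) + 2 * ∑ maps (size (suc j)) ≤ 2 * ∑ maps (size j)
  ∑-redundancy-bound j = begin
    ∑ maps (redundancy j) + 2 * ∑ maps (size (suc j))
      ≡⟨ trans (∑-distrib-+ maps (redundancy j) _)
           (cong (∑ maps (redundancy j) +_) (∑-distribˡ-* 2 maps (size (suc j)))) ⟨
    ∑[ g ∈ maps ] (redundancy j g + 2 * size (suc j) g)
      ≤⟨ ∑-mono maps (redundancy-bound j) ⟩
    ∑[ g ∈ maps ] 2 * size j g
      ≡⟨ ∑-distribˡ-* 2 maps (size j) ⟩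
    2 * ∑ maps (size j)
      ∎
    where open ≤-Reasoning

  -- The term 8 J e′ is split into gain, orbit and light parts. The gain part costs J² times the
  -- redundancy, which the 2 J² e′ added to both sides turns into 2 J² e; the light part costs 2 J
  -- e. The resulting factor (J + 1) / (J + 4) alone would give decay of order 1 / J³, which leaves
  -- room to absorb the source term 32 M G at the rate M / J.
  recurrence : ∀ j → let J = suc j in
    J * (J + 4) * ∑ maps (size (suc j)) ≤
    J * (J + 1) * ∑ maps (size j) + (32 * (M * G) + 4 * (J * J * G))
  recurrence j = *-cancelˡ-≤ 2 (begin
    2 * (J * (J + 4) * e′)
      ≡⟨ eq₁ J e′ ⟩
    8 * (J * e′) + 2 * (J * J * e′)
      ≤⟨ +-monoˡ-≤ _ (*-monoʳ-≤ 8 (*-monoʳ-≤ J (size≤gain+light j))) ⟩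
    8 * (J * (W + J * G + L)) + 2 * (J * J * e′)
      ≡⟨ eq₂ J W G L e′ ⟩
    8 * (J * W) + (2 * J * (4 * L) + 8 * (J * J * G) + 2 * (J * J * e′))
      ≤⟨ +-mono-≤ (gain≤redundancy j)
           (+-monoˡ-≤ _ (+-monoˡ-≤ _ (*-monoʳ-≤ (2 * J) (4*lightSize≤size j)))) ⟩
    J * J * R + 64 * (M * G) + (2 * J * e + 8 * (J * J * G) + 2 * (J * J * e′))
      ≡⟨ eq₃ J R (M * G) e G e′ ⟩
    J * J * (R + 2 * e′) + (64 * (M * G) + 2 * J * e + 8 * (J * J * G))
      ≤⟨ +-monoˡ-≤ _ (*-monoʳ-≤ (J * J) (∑-redundancy-bound j)) ⟩
    J * J * (2 * e) + (64 * (M * G) + 2 * J * e + 8 * (J * J * G))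
      ≡⟨ eq₄ J (M * G) e G ⟩
    2 * (J * (J + 1) * e + (32 * (M * G) + 4 * (J * J * G)))
      ∎)
    where
    open ≤-Reasoning
    J e e′ R W L : ℕ
    J  = suc j
    e  = ∑ maps (size j)
    e′ = ∑ maps (size (suc j))
    R  = ∑ maps (redundancy j)
    W  = ∑ maps (gain j)
    L  = ∑ maps (lightSize (suc j))
    eq₁ : ∀ J e′ → 2 * (J * (J + 4) * e′) ≡ 8 * (J * e′) + 2 * (J * J * e′)
    eq₁ = solve-∀
    eq₂ : ∀ J W G L e′ → 8 * (J * (W + J * G + L)) + 2 * (J * J * e′) ≡
          8 * (J * W) + (2 * J * (4 * L) + 8 * (J * J * G) + 2 * (J * J * e′))
    eq₂ = solve-∀
    eq₃ : ∀ J R F e G e′ →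
          J * J * R + 64 * F + (2 * J * e + 8 * (J * J * G) + 2 * (J * J * e′)) ≡
          J * J * (R + 2 * e′) + (64 * F + 2 * J * e + 8 * (J * J * G))
    eq₃ = solve-∀
    eq₄ : ∀ J F e G → J * J * (2 * e) + (64 * F + 2 * J * e + 8 * (J * J * G)) ≡
          2 * (J * (J + 1) * e + (32 * F + 4 * (J * J * G)))
    eq₄ = solve-∀

  -- Induction by `recurrence`. The square in the bound pays for the term 4 J² G, which comes from
  -- the excluded orbit points.
  size-bound : ∀ j → suc j * ∑ maps (size j) ≤ (64 * M + suc j * suc j) * G
  size-bound zero = begin
    -- By definition `T g 0` is the image of `φ`, so `size 0 g` reduces to `M` for every `g`.
    1 * ∑ maps (size 0)     ≡⟨ trans (*-identityˡ _) (∑-const maps M) ⟩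
    G * M                   ≤⟨ m≤m+n (G * M) (63 * (M * G) + G) ⟩
    G * M + (63 * (M * G) + G) ≡⟨ eq G M ⟩
    (64 * M + 1 * 1) * G    ∎
    where
    open ≤-Reasoning
    eq : ∀ G M → G * M + (63 * (M * G) + G) ≡ (64 * M + 1 * 1) * G
    eq = solve-∀
  size-bound (suc j) = *-cancelˡ-≤ (suc j * (suc j + 4)) (begin
    J * (J + 4) * (K * e′)
      ≡⟨ eq₁ J K e′ ⟩
    K * (J * (J + 4) * e′)
      ≤⟨ *-monoʳ-≤ K (recurrence j) ⟩
    K * (J * (J + 1) * e + (32 * (M * G) + 4 * (J * J * G)))
      ≡⟨ eq₂ J K e (M * G) G ⟩
    K * ((J + 1) * (J * e) + (32 * (M * G) + 4 * (J * J * G)))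
      ≤⟨ *-monoʳ-≤ K (+-monoˡ-≤ _ (*-monoʳ-≤ (J + 1) (size-bound j))) ⟩
    K * ((J + 1) * ((64 * M + J * J) * G) + (32 * (M * G) + 4 * (J * J * G)))
      -- The added terms are the exact slack in `eq₃`. The part with `M` vanishes at j = 0, where 64
      -- is the least constant for which the induction step goes through.
      ≤⟨ m≤m+n _ (96 * j * M * G + 4 * J * K * G) ⟩
    K * ((J + 1) * ((64 * M + J * J) * G) + (32 * (M * G) + 4 * (J * J * G)))
      + (96 * j * M * G + 4 * J * K * G)
      ≡⟨ eq₃ j M G ⟩
    J * (J + 4) * ((64 * M + K * K) * G)
      ∎)
    where
    open ≤-Reasoning
    J K e e′ : ℕ
    J  = suc j
    K  = suc J
    e  = ∑ maps (size j)
    e′ = ∑ maps (size J)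
    eq₁ : ∀ J K e′ → J * (J + 4) * (K * e′) ≡ K * (J * (J + 4) * e′)
    eq₁ = solve-∀
    eq₂ : ∀ J K e F G → K * (J * (J + 1) * e + (32 * F + 4 * (J * J * G))) ≡
          K * ((J + 1) * (J * e) + (32 * F + 4 * (J * J * G)))
    eq₂ = solve-∀
    eq₃ : ∀ j M G → let J = 1 + j; K = 2 + j in
          K * ((J + 1) * ((64 * M + J * J) * G) + (32 * (M * G) + 4 * (J * J * G)))
            + (96 * j * M * G + 4 * J * K * G) ≡
          J * (J + 4) * ((64 * M + K * K) * G)
    eq₃ = solve-∀

  -- Points on short cycles, and the main estimate.

  cyclic? : ∀ k g x → Dec (Visits (step g) k (step g x) x)
  cyclic? k g x = visits? (step g) k (step g x) x

  -- After `g x` is resampled to `z`, the point `x` returns to itself only if the orbit of `φ z`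
  -- under the unchanged map reaches `x`. For fixed `g` and `z` that orbit has at most `k + 1`
  -- points, so at most `k + 1` choices of `x` succeed.
  ∑-cyclic : ∀ k → ∑[ g ∈ maps ] ∑[ x ∈ allFin n ] ⟦ cyclic? k g x ⟧ ≤ suc k * G
  ∑-cyclic k = *-cancelˡ-≤ n (begin
    n * (∑[ g ∈ maps ] ∑[ x ∈ allFin n ] ⟦ cyclic? k g x ⟧)
      ≡⟨ cong (n *_) (∑-swap maps (allFin n) _) ⟩
    n * (∑[ x ∈ allFin n ] ∑[ g ∈ maps ] ⟦ cyclic? k g x ⟧)
      ≡⟨ ∑-distribˡ-* n (allFin n) _ ⟨
    ∑[ x ∈ allFin n ] n * (∑[ g ∈ maps ] ⟦ cyclic? k g x ⟧)
      ≡⟨ ∑-cong (allFin n) (λ x → ∑-resample x λ g → ⟦ cyclic? k g x ⟧) ⟨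
    ∑[ x ∈ allFin n ] ∑[ g ∈ maps ] ∑[ z ∈ allFin n ] ⟦ cyclic? k (g [ x ↦ z ]) x ⟧
      ≡⟨ ∑-swap (allFin n) maps _ ⟩
    ∑[ g ∈ maps ] ∑[ x ∈ allFin n ] ∑[ z ∈ allFin n ] ⟦ cyclic? k (g [ x ↦ z ]) x ⟧
      ≡⟨ ∑-cong maps (λ g → ∑-swap (allFin n) (allFin n) _) ⟩
    ∑[ g ∈ maps ] ∑[ z ∈ allFin n ] ∑[ x ∈ allFin n ] ⟦ cyclic? k (g [ x ↦ z ]) x ⟧
      ≤⟨ ∑-mono maps (λ g → ∑-mono (allFin n) λ z → ∑-mono (allFin n) λ x → independent g z x) ⟩
    ∑[ g ∈ maps ] ∑[ z ∈ allFin n ] ∑[ x ∈ allFin n ] ⟦ visits? (step g) k (φ z) x ⟧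
      ≤⟨ ∑-mono maps (λ g → ∑-mono (allFin n) λ z → ∑-visits (step g) k (φ z)) ⟩
    ∑[ g ∈ maps ] ∑[ z ∈ allFin n ] suc k
      ≡⟨ ∑-cong maps (λ _ → ∑-allFin-const n (suc k)) ⟩
    ∑[ g ∈ maps ] n * suc k
      ≡⟨ ∑-const maps (n * suc k) ⟩
    G * (n * suc k)
      ≡⟨ rearrange G n (suc k) ⟩
    n * (suc k * G)
      ∎)
    where
    open ≤-Reasoning
    rearrange : ∀ p q r → p * (q * r) ≡ q * (r * p)
    rearrange = solve-∀
    independent : ∀ g z x → ⟦ cyclic? k (g [ x ↦ z ]) x ⟧ ≤ ⟦ visits? (step g) k (φ z) x ⟧
    independent g z x = ⟦⟧-mono (cyclic? k (g [ x ↦ z ]) x) (visits? (step g) k (φ z) x) λ visit →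
      Visits-agree (step-agree⁻¹ g x z) k
        (subst (λ y → Visits (step (g [ x ↦ z ])) k (φ y) x) ([↦]-updates g x z) visit)

  iterateImage? : ∀ k g y → Dec (∃ λ u → iterate (step g) (φ u) k ≡ y)
  iterateImage? k g y = any? λ u → iterate (step g) (φ u) k ≟ᶠ y

  -- The square of `suc k` occurs twice, once from `size-bound` for the points of T_k and once from
  -- `∑-cyclic` for the remaining ones.
  ∑-iterateImage : ∀ k → suc k * (∑[ g ∈ maps ] ∑[ y ∈ allFin n ] ⟦ iterateImage? k g y ⟧) ≤
                   (64 * M + 2 * (suc k * suc k)) * G
  ∑-iterateImage k = begin
    suc k * (∑[ g ∈ maps ] ∑[ y ∈ allFin n ] ⟦ iterateImage? k g y ⟧)
      ≤⟨ *-monoʳ-≤ (suc k) (∑-mono maps λ g → ∑-mono (allFin n) (pointwise g)) ⟩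
    suc k * (∑[ g ∈ maps ] ∑[ y ∈ allFin n ] (⟦ T? g k y ⟧ + ⟦ cyclic? k g y ⟧))
      ≡⟨ cong (suc k *_) (trans (∑-cong maps λ g → ∑-distrib-+ (allFin n) _ _) (∑-distrib-+ maps _ _)) ⟩
    suc k * (∑ maps (size k) + (∑[ g ∈ maps ] ∑[ x ∈ allFin n ] ⟦ cyclic? k g x ⟧))
      ≡⟨ *-distribˡ-+ (suc k) (∑ maps (size k)) _ ⟩
    suc k * ∑ maps (size k) + suc k * (∑[ g ∈ maps ] ∑[ x ∈ allFin n ] ⟦ cyclic? k g x ⟧)
      ≤⟨ +-mono-≤ (size-bound k) (*-monoʳ-≤ (suc k) (∑-cyclic k)) ⟩
    (64 * M + suc k * suc k) * G + suc k * (suc k * G)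
      ≡⟨ eq M (suc k) G ⟩
    (64 * M + 2 * (suc k * suc k)) * G
      ∎
    where
    open ≤-Reasoning
    eq : ∀ M K G → (64 * M + K * K) * G + K * (K * G) ≡ (64 * M + 2 * (K * K)) * G
    eq = solve-∀
    pointwise : ∀ g y → ⟦ iterateImage? k g y ⟧ ≤ ⟦ T? g k y ⟧ + ⟦ cyclic? k g y ⟧
    pointwise g y = ≤-trans (⟦⟧-mono (iterateImage? k g y) (T? g k y ⊎-dec cyclic? k g y) split)
      (⟦⟧-⊎ (T? g k y) (cyclic? k g y))
      where
      split : (∃ λ u → iterate (step g) (φ u) k ≡ y) → T g k y ⊎ Visits (step g) k (step g y) y
      split (u , eq) with iterate⇒FirstHit⊎cyclic (step g) k eq
      ... | inj₁ hit   = inj₁ (u , hit)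
      ... | inj₂ cycle = inj₂ cycle

-- Sums over automata
∑-sum : ∀ (f : Fin n → ℕ) → sum f ≡ ∑ (allFin n) f
∑-sum {zero}  f = refl
∑-sum {suc n} f = trans (cong (f zero +_) (∑-sum (f ∘ suc))) (sym (∑-allFin-suc f))

∑-+-split : ∀ m n (f : Fin (m + n) → ℕ) →
  ∑ (allFin (m + n)) f ≡ (∑[ i ∈ allFin m ] f (i ↑ˡ n)) + (∑[ j ∈ allFin n ] f (m ↑ʳ j))
∑-+-split zero    n f = refl
∑-+-split (suc m) n f = begin
  ∑ (allFin (suc m + n)) f
    ≡⟨ ∑-allFin-suc f ⟩
  f zero + ∑ (allFin (m + n)) (f ∘ suc)
    ≡⟨ cong (f zero +_) (∑-+-split m n (f ∘ suc)) ⟩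
  f zero + ((∑[ i ∈ allFin m ] f (suc i ↑ˡ n)) + (∑[ j ∈ allFin n ] f (suc m ↑ʳ j)))
    ≡⟨ +-assoc (f zero) _ _ ⟨
  f zero + (∑[ i ∈ allFin m ] f (suc i ↑ˡ n)) + (∑[ j ∈ allFin n ] f (suc m ↑ʳ j))
    ≡⟨ cong (_+ (∑[ j ∈ allFin n ] f (suc m ↑ʳ j))) (∑-allFin-suc (λ i → f (i ↑ˡ n))) ⟨
  (∑[ i ∈ allFin (suc m) ] f (i ↑ˡ n)) + (∑[ j ∈ allFin n ] f (suc m ↑ʳ j))
    ∎
  where open ≡-Reasoning

∑-combine : ∀ m n (f : Fin (m * n) → ℕ) →
  ∑ (allFin (m * n)) f ≡ ∑[ i ∈ allFin m ] ∑[ j ∈ allFin n ] f (combine i j)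
∑-combine zero    n f = refl
∑-combine (suc m) n f = begin
  ∑ (allFin (n + m * n)) f
    ≡⟨ ∑-+-split n (m * n) f ⟩
  (∑[ j ∈ allFin n ] f (j ↑ˡ (m * n))) + (∑[ k ∈ allFin (m * n) ] f (n ↑ʳ k))
    ≡⟨ cong ((∑[ j ∈ allFin n ] f (j ↑ˡ (m * n))) +_) (∑-combine m n (λ k → f (n ↑ʳ k))) ⟩
  (∑[ j ∈ allFin n ] f (j ↑ˡ (m * n))) + (∑[ i ∈ allFin m ] ∑[ j ∈ allFin n ] f (combine (suc i) j))
    ≡⟨ ∑-allFin-suc {m} (λ i → ∑[ j ∈ allFin n ] f (combine i j)) ⟨
  ∑[ i ∈ allFin (suc m) ] ∑[ j ∈ allFin n ] f (combine i j)
    ∎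
  where open ≡-Reasoning

-- The decoded map `finToFun (combine z i)` and the listed map `z Vec.∷ finToFun i` are compared
-- only pointwise, so `F` has to respect pointwise equality.
∑-finToFun : ∀ m n (F : (Fin m → Fin n) → ℕ) → (∀ {g g′} → g ≗ g′ → F g ≡ F g′) →
  ∑ (allFin (n ^ m)) (F ∘ finToFun) ≡ ∑ (functions m n) F
∑-finToFun zero    n F F-cong = cong (_+ 0) (F-cong λ ())
∑-finToFun (suc m) n F F-cong = begin
  ∑ (allFin (n * n ^ m)) (F ∘ finToFun)
    ≡⟨ ∑-combine n (n ^ m) _ ⟩
  ∑[ z ∈ allFin n ] ∑[ i ∈ allFin (n ^ m) ] F (finToFun (combine z i))
    ≡⟨ ∑-cong (allFin n) (λ z → ∑-cong (allFin (n ^ m)) λ i → F-cong (pointwise z i)) ⟩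
  ∑[ z ∈ allFin n ] ∑[ i ∈ allFin (n ^ m) ] F (z Vec.∷ finToFun i)
    ≡⟨ ∑-cong (allFin n) (λ z → ∑-finToFun m n (λ g → F (z Vec.∷ g)) λ eq →
         F-cong λ { zero → refl ; (suc x) → eq x }) ⟩
  ∑[ z ∈ allFin n ] ∑[ g ∈ functions m n ] F (z Vec.∷ g)
    ≡⟨ ∑-functions-suc m n F ⟨
  ∑ (functions (suc m) n) F
    ∎
  where
  open ≡-Reasoning
  pointwise : ∀ z i → finToFun {n} {suc m} (combine z i) ≗ (z Vec.∷ finToFun i)
  pointwise z i zero    = cong proj₁ (remQuot-combine z i)
  pointwise z i (suc x) = cong (λ p → finToFun (proj₂ p) x) (remQuot-combine z i)

-- This is the layout of the transition table under `combine x (code c)`: the two values at a state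
-- are adjacent, matching the reduction of `suc m * 2` to two successors.
interleave : ∀ {m} → (Fin m → Fin n) → (Fin m → Fin n) → Fin (m * 2) → Fin n
interleave {m = zero}  f g = λ ()
interleave {m = suc m} f g =
  Vec.head f Vec.∷ (Vec.head g Vec.∷ interleave (Vec.tail f) (Vec.tail g))

∑-interleave : ∀ m n (F : (Fin (m * 2) → Fin n) → ℕ) →
  ∑ (functions (m * 2) n) F ≡ ∑[ f ∈ functions m n ] ∑[ g ∈ functions m n ] F (interleave f g)
∑-interleave zero    n F = cong (_+ 0) (sym (+-identityʳ _))
∑-interleave (suc m) n F = begin
  ∑ (functions (suc m * 2) n) F
    ≡⟨ ∑-functions-suc (suc (m * 2)) n F ⟩
  ∑[ z ∈ allFin n ] ∑[ r ∈ functions (suc (m * 2)) n ] F (z Vec.∷ r)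
    ≡⟨ ∑-cong (allFin n) (λ z → ∑-functions-suc (m * 2) n λ r → F (z Vec.∷ r)) ⟩
  ∑[ z ∈ allFin n ] ∑[ w ∈ allFin n ] ∑[ r ∈ functions (m * 2) n ] F (z Vec.∷ (w Vec.∷ r))
    ≡⟨ ∑-cong (allFin n) (λ z → ∑-cong (allFin n) λ w →
         ∑-interleave m n λ r → F (z Vec.∷ (w Vec.∷ r))) ⟩
  ∑[ z ∈ allFin n ] ∑[ w ∈ allFin n ] ∑[ f ∈ functions m n ] ∑[ g ∈ functions m n ]
    F (z Vec.∷ (w Vec.∷ interleave f g))
    ≡⟨ ∑-cong (allFin n) (λ z → ∑-swap (allFin n) (functions m n) _) ⟩
  ∑[ z ∈ allFin n ] ∑[ f ∈ functions m n ] ∑[ w ∈ allFin n ] ∑[ g ∈ functions m n ]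
    F (z Vec.∷ (w Vec.∷ interleave f g))
    ≡⟨ ∑-cong (allFin n) (λ z → ∑-cong (functions m n) λ f →
         ∑-functions-suc m n λ g → F (interleave (z Vec.∷ f) g)) ⟨
  ∑[ z ∈ allFin n ] ∑[ f ∈ functions m n ] ∑[ g ∈ functions (suc m) n ] F (interleave (z Vec.∷ f) g)
    ≡⟨ ∑-functions-suc m n (λ f → ∑[ g ∈ functions (suc m) n ] F (interleave f g)) ⟨
  ∑[ f ∈ functions (suc m) n ] ∑[ g ∈ functions (suc m) n ] F (interleave f g)
    ∎
  where open ≡-Reasoning

fromMaps : (Fin n → Fin n) → (Fin n → Fin n) → Automaton n
fromMaps f g x a = f x
fromMaps f g x b = g x

interleave-combine : ∀ {m} (f g : Fin m → Fin n) x →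
  interleave f g (combine x zero) ≡ f x × interleave f g (combine x (suc zero)) ≡ g x
interleave-combine f g zero    = refl , refl
interleave-combine f g (suc x) = interleave-combine (Vec.tail f) (Vec.tail g) x

-- A uniform automaton amounts to two independent uniform maps, which permits fixing the map of `a`
-- and averaging over that of `b` first.
∑-automaton : ∀ n (F : Automaton n → ℕ) →
  (∀ {δ δ′} → (∀ x c → δ x c ≡ δ′ x c) → F δ ≡ F δ′) →
  sum (λ i → F (automaton i)) ≡ ∑[ f ∈ functions n n ] ∑[ g ∈ functions n n ] F (fromMaps f g)
∑-automaton n F F-cong = begin
  sum (λ i → F (automaton i))
    ≡⟨ ∑-sum (λ i → F (automaton i)) ⟩
  ∑ (allFin (n ^ (n * 2))) (F∘table ∘ finToFun)
    ≡⟨ ∑-finToFun (n * 2) n F∘table (λ eq → F-cong λ x c → eq (combine x (code c))) ⟩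
  ∑ (functions (n * 2) n) F∘table
    ≡⟨ ∑-interleave n n F∘table ⟩
  ∑[ f ∈ functions n n ] ∑[ g ∈ functions n n ] F∘table (interleave f g)
    ≡⟨ ∑-cong (functions n n) (λ f → ∑-cong (functions n n) λ g → F-cong (pointwise f g)) ⟩
  ∑[ f ∈ functions n n ] ∑[ g ∈ functions n n ] F (fromMaps f g)
    ∎
  where
  open ≡-Reasoning
  F∘table : (Fin (n * 2) → Fin n) → ℕ
  F∘table r = F (λ x c → r (combine x (code c)))
  pointwise : ∀ f g x c → interleave f g (combine x (code c)) ≡ fromMaps f g x c
  pointwise f g x a = proj₁ (interleave-combine f g x)
  pointwise f g x b = proj₂ (interleave-combine f g x)

-- The word as an iterated map, and the size of its image.

iterate-cong : ∀ {f g : X → X} → f ≗ g → ∀ x k → iterate f x k ≡ iterate g x k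
iterate-cong f≗g x zero    = refl
iterate-cong {g = g} f≗g x (suc k) =
  trans (iterate-cong f≗g _ k) (cong (λ y → iterate g y k) (f≗g x))

δ⟨⟩-cong : ∀ {δ δ′ : Automaton n} → (∀ x c → δ x c ≡ δ′ x c) → ∀ w x → δ⟨ w ⟩ δ x ≡ δ⟨ w ⟩ δ′ x
δ⟨⟩-cong eq []      x = refl
δ⟨⟩-cong {δ′ = δ′} eq (c ∷ w) x = trans (δ⟨⟩-cong eq w _) (cong (δ⟨ w ⟩ δ′) (eq x c))

δ⟨^ʷ⟩ : ∀ (δ : Automaton n) u k x → δ⟨ u ^ʷ k ⟩ δ x ≡ iterate (δ⟨ u ⟩ δ) x k
δ⟨^ʷ⟩ δ u zero    x = refl
δ⟨^ʷ⟩ δ u (suc k) x = trans (foldl-++ δ x u (u ^ʷ k)) (δ⟨^ʷ⟩ δ u k (δ⟨ u ⟩ δ x))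

∣tabulate∣ : ∀ {P : Fin n → Set} (P? : ∀ y → Dec (P y)) →
             ∣ Vec′.tabulate (λ y → does (P? y)) ∣ ≡ ∑[ y ∈ allFin n ] ⟦ P? y ⟧
∣tabulate∣ {zero}  P? = refl
∣tabulate∣ {suc n} P? = trans head-first (sym (∑-allFin-suc λ y → ⟦ P? y ⟧))
  where
  head-first : ∣ Vec′.tabulate (λ y → does (P? y)) ∣ ≡ ⟦ P? zero ⟧ + (∑[ y ∈ allFin n ] ⟦ P? (suc y) ⟧)
  head-first with P? zero
  ... | yes _ = cong suc (∣tabulate∣ (λ y → P? (suc y)))
  ... | no _  = ∣tabulate∣ (λ y → P? (suc y))

∣image∣ : ∀ (f : Fin n → Fin n) → ∣ image f ⊤ ∣ ≡ ∑[ y ∈ allFin n ] ⟦ any? (λ x → f x ≟ᶠ y) ⟧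
∣image∣ {n} f = trans (∣tabulate∣ λ y → any? λ x → x ∈? ⊤ ×-dec f x ≟ᶠ y)
  (∑-cong (allFin n) λ y → ⟦⟧-cong (any? λ x → x ∈? ⊤ ×-dec f x ≟ᶠ y) (any? λ x → f x ≟ᶠ y)
    (λ (x , _ , eq) → x , eq) (λ (x , eq) → x , ∈⊤ , eq))

∣image∣-cong : ∀ {f g : Fin n → Fin n} → f ≗ g → ∣ image f ⊤ ∣ ≡ ∣ image g ⊤ ∣
∣image∣-cong {n} {f} {g} f≗g = trans (∣image∣ f) (trans
  (∑-cong (allFin n) λ y → ⟦⟧-cong (any? λ x → f x ≟ᶠ y) (any? λ x → g x ≟ᶠ y)
    (λ (x , eq) → x , trans (sym (f≗g x)) eq) (λ (x , eq) → x , trans (f≗g x) eq))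
  (sym (∣image∣ g)))

-- The word `ω n` with its two exponents as parameters: the counting estimate holds for all `s` and
-- `k`, and the ceilings are substituted afterwards.
alternating : ℕ → ℕ → Word
alternating s k = aˢ ++ ((b ∷ aˢ) ^ʷ k)
  where aˢ = (a ∷ []) ^ʷ s

δ⟨alternating⟩ : ∀ (f g : Fin n → Fin n) s k x → let φ = λ y → iterate f y s in
  δ⟨ alternating s k ⟩ (fromMaps f g) x ≡ iterate (λ y → φ (g y)) (φ x) k
δ⟨alternating⟩ f g s k x = begin
  δ⟨ aˢ ++ ((b ∷ aˢ) ^ʷ k) ⟩ δ x
    ≡⟨ foldl-++ δ x aˢ _ ⟩
  δ⟨ (b ∷ aˢ) ^ʷ k ⟩ δ (δ⟨ aˢ ⟩ δ x)
    ≡⟨ cong (δ⟨ (b ∷ aˢ) ^ʷ k ⟩ δ) (δ⟨^ʷ⟩ δ (a ∷ []) s x) ⟩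
  δ⟨ (b ∷ aˢ) ^ʷ k ⟩ δ (iterate f x s)
    ≡⟨ δ⟨^ʷ⟩ δ (b ∷ aˢ) k (iterate f x s) ⟩
  iterate (δ⟨ b ∷ aˢ ⟩ δ) (iterate f x s) k
    ≡⟨ iterate-cong (λ y → δ⟨^ʷ⟩ δ (a ∷ []) s (g y)) (iterate f x s) k ⟩
  iterate (λ y → iterate f (g y) s) (iterate f x s) k
    ∎
  where
  open ≡-Reasoning
  δ = fromMaps f g
  aˢ = (a ∷ []) ^ʷ s

-- The two applications of the main estimate.

∑-iterate-image : ∀ n .{{_ : NonZero n}} s →
  suc s * (∑[ f ∈ functions n n ] RandomMap.M (λ y → iterate f y s)) ≤
  (64 * n + 2 * (suc s * suc s)) * n ^ n
∑-iterate-image n s = subst₂ (λ M G → suc s * (∑[ f ∈ functions n n ] ∑[ y ∈ allFin n ] ⟦ iterateImage? s f y ⟧) ≤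
    (64 * M + 2 * (suc s * suc s)) * G) M≡n (length-functions n n) (∑-iterateImage s)
  where
  -- For `φ = id` the random map of the module plays the part of `f`, and its iterated image
  -- `iterateImage? s f` is definitionally the `imageφ?` of the second application, where `φ` is the
  -- iterate of `f`.
  open RandomMap {n} id
  M≡n : M ≡ n
  M≡n = trans (∑-cong (allFin n) λ y → ⟦⟧-yes (imageφ? y) (y , refl))
    (trans (∑-allFin-const n 1) (*-identityʳ n))

-- For fixed `f` the main estimate bounds the sum over `g` by a multiple of `R.M f` plus a
-- lower-order term; `∑-iterate-image` then bounds the sum of `R.M f` over `f`. The factors `suc s`
-- and `suc k` clear the denominators of the two applications.
∑∣image-alternating∣ : ∀ n .{{_ : NonZero n}} s k →
  suc s * (suc k * sum (λ i → ∣ image (δ⟨ alternating s k ⟩ (automaton {n} i)) ⊤ ∣)) ≤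
  (64 * (64 * n + 2 * (suc s * suc s)) + 2 * (suc k * suc k) * suc s) * n ^ (n * 2)
∑∣image-alternating∣ n s k = begin
  suc s * (suc k * sum (λ i → ∣ image (δ⟨ alternating s k ⟩ (automaton {n} i)) ⊤ ∣))
    ≡⟨ cong (λ t → suc s * (suc k * t)) (trans
         (∑-automaton n (λ δ → ∣ image (δ⟨ alternating s k ⟩ δ) ⊤ ∣)
           λ eq → ∣image∣-cong (δ⟨⟩-cong eq (alternating s k)))
         (∑-cong maps λ f → ∑-cong maps λ g → trans
           (∣image∣-cong (δ⟨alternating⟩ f g s k))
           (∣image∣ (λ x → iterate (λ y → φ f (g y)) (φ f x) k)))) ⟩
  suc s * (suc k * (∑[ f ∈ maps ] B f))
    ≡⟨ cong (suc s *_) (∑-distribˡ-* (suc k) maps B) ⟨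
  suc s * (∑[ f ∈ maps ] suc k * B f)
    ≤⟨ *-monoʳ-≤ (suc s) (∑-mono maps λ f → R.∑-iterateImage f k) ⟩
  suc s * (∑[ f ∈ maps ] (64 * R.M f + 2 * (suc k * suc k)) * length maps)
    ≡⟨ cong (suc s *_) (trans (∑-distribʳ-* (length maps) maps _) (cong (_* length maps)
         (trans (∑-distrib-+ maps _ _) (cong₂ _+_ (∑-distribˡ-* 64 maps R.M) (∑-const maps _))))) ⟩
  suc s * ((64 * ∑ maps R.M + length maps * (2 * (suc k * suc k))) * length maps)
    ≡⟨ cong (λ G → suc s * ((64 * ∑ maps R.M + G * (2 * (suc k * suc k))) * G)) (length-functions n n) ⟩
  suc s * ((64 * ∑ maps R.M + n ^ n * (2 * (suc k * suc k))) * n ^ n)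
    ≡⟨ eq₁ (suc s) (∑ maps R.M) (n ^ n) (2 * (suc k * suc k)) ⟩
  (64 * (suc s * ∑ maps R.M) + suc s * (n ^ n * (2 * (suc k * suc k)))) * n ^ n
    ≤⟨ *-monoˡ-≤ (n ^ n) (+-monoˡ-≤ _ (*-monoʳ-≤ 64 (∑-iterate-image n s))) ⟩
  (64 * ((64 * n + 2 * (suc s * suc s)) * n ^ n) + suc s * (n ^ n * (2 * (suc k * suc k)))) * n ^ n
    ≡⟨ eq₂ (suc s) (64 * n + 2 * (suc s * suc s)) (n ^ n) (2 * (suc k * suc k)) ⟩
  (64 * (64 * n + 2 * (suc s * suc s)) + 2 * (suc k * suc k) * suc s) * (n ^ n * (n ^ n * 1))
    ≡⟨ cong (C *_) (^-*-assoc n n 2) ⟩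
  (64 * (64 * n + 2 * (suc s * suc s)) + 2 * (suc k * suc k) * suc s) * n ^ (n * 2)
    ∎
  where
  open ≤-Reasoning
  maps = functions n n
  C : ℕ
  C = 64 * (64 * n + 2 * (suc s * suc s)) + 2 * (suc k * suc k) * suc s
  φ : (Fin n → Fin n) → Fin n → Fin n
  φ f y = iterate f y s
  module R f = RandomMap (φ f)
  B : (Fin n → Fin n) → ℕ
  B f = ∑[ g ∈ maps ] ∑[ y ∈ allFin n ] ⟦ R.iterateImage? f k g y ⟧
  eq₁ : ∀ s e G c → s * ((64 * e + G * c) * G) ≡ (64 * (s * e) + s * (G * c)) * G
  eq₁ = solve-∀
  eq₂ : ∀ s d G c → (64 * (d * G) + s * (G * c)) * G ≡ (64 * d + c * s) * (G * (G * 1))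
  eq₂ = solve-∀

-- Ceilings and real bounds

p²≤q²⇒p≤q : ∀ {p q} → p * p ≤ q * q → p ≤ q
p²≤q²⇒p≤q le = ≮⇒≥ λ q<p → ≤⇒≯ le (*-mono-< q<p q<p)

n<2^n : ∀ n → n < 2 ^ n
n<2^n zero    = s≤s z≤n
n<2^n (suc n) = ≤-trans (+-mono-≤ (m^n>0 2 n) (n<2^n n)) (+-monoʳ-≤ (2 ^ n) (m≤m+n (2 ^ n) 0))

-- This makes the error term in k negligible against s. For k = j + 1 one has k + 1 ≤ 2^k, so the
-- fourth power of k + 1 is at most 2^(4 j + 4), and 4 j + 4 ≤ j² + 8; the factor 2^8 becomes 16
-- after the square root.
[1+k]²≤16s : ∀ k s → 1 ≤ s → (∀ j → k ≡ suc j → 2 ^ (j * j) ≤ s * s) → suc k * suc k ≤ 16 * s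
[1+k]²≤16s zero    s 1≤s _ = ≤-trans 1≤s (m≤m+n s (15 * s))
[1+k]²≤16s (suc j) s 1≤s h = p²≤q²⇒p≤q (begin
  K * K * (K * K)
    ≤⟨ *-mono-≤ (*-mono-≤ K≤W K≤W) (*-mono-≤ K≤W K≤W) ⟩
  W * W * (W * W)
    ≡⟨ cong₂ _*_ (sym (^-distribˡ-+-* 2 J J)) (sym (^-distribˡ-+-* 2 J J)) ⟩
  2 ^ (J + J) * 2 ^ (J + J)
    ≡⟨ ^-distribˡ-+-* 2 (J + J) (J + J) ⟨
  2 ^ (J + J + (J + J))
    ≤⟨ ^-monoʳ-≤ 2 exponent ⟩
  2 ^ (j * j + 8)
    ≡⟨ ^-distribˡ-+-* 2 (j * j) 8 ⟩
  2 ^ (j * j) * 256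
    ≤⟨ *-monoˡ-≤ 256 (h j refl) ⟩
  s * s * 256
    ≡⟨ eq₁ s ⟩
  16 * s * (16 * s)
    ∎)
  where
  open ≤-Reasoning
  J K W : ℕ
  J = suc j
  K = suc J
  W = 2 ^ J
  K≤W : K ≤ W
  K≤W = n<2^n J
  eq₁ : ∀ s → s * s * 256 ≡ 16 * s * (16 * s)
  eq₁ = solve-∀
  eq₂ : ∀ j → 1 + j + (1 + j) + (1 + j + (1 + j)) ≡ 2 * (j * 2) + 4
  eq₂ = solve-∀
  exponent : J + J + (J + J) ≤ j * j + 8
  exponent = begin
    J + J + (J + J)       ≡⟨ eq₂ j ⟩
    2 * (j * 2) + 4       ≤⟨ +-monoˡ-≤ 4 (2ab≤a²+b² j 2) ⟩
    j * j + 4 + 4         ≡⟨ +-assoc (j * j) 4 4 ⟩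
    j * j + 8             ∎

ι : ℕ → ℚ
ι n = ℤ.+ n ℚ./ 1

ι≡mkℚ : ∀ n → ι n ≡ mkℚ (ℤ.+ n) 0 (Coprimality.sym (1-coprimeTo n))
ι≡mkℚ n = ℚ.normalize-coprime (Coprimality.sym (1-coprimeTo n))

ι-* : ∀ p q → ι (p * q) ≡ ι p ℚ.* ι q
ι-* p q = trans (cong (ℚ._/ 1) (ℤ.pos-* p q)) (sym (cong₂ ℚ._*_ (ι≡mkℚ p) (ι≡mkℚ q)))

ι-mono-< : ∀ {p q} → p < q → ι p ℚ.< ι q
ι-mono-< {p} {q} p<q = subst₂ ℚ._<_ (sym (ι≡mkℚ p)) (sym (ι≡mkℚ q))
  (ℚ.*<* (subst₂ ℤ._<_ (sym (ℤ.*-identityʳ (ℤ.+ p))) (sym (ℤ.*-identityʳ (ℤ.+ q))) (ℤ.+<+ p<q)))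

ι-mono-≤ : ∀ {p q} → p ≤ q → ι p ℚ.≤ ι q
ι-mono-≤ {p} {q} p≤q = subst₂ ℚ._≤_ (sym (ι≡mkℚ p)) (sym (ι≡mkℚ q))
  (ℚ.*≤* (subst₂ ℤ._≤_ (sym (ℤ.*-identityʳ (ℤ.+ p))) (sym (ℤ.*-identityʳ (ℤ.+ q))) (ℤ.+≤+ p≤q)))

0≤ι : ∀ n → 0ℚ ℚ.≤ ι n
0≤ι n = ι-mono-≤ {0} {n} z≤n

ι-cancel-< : ∀ {p q} → ι p ℚ.< ι q → p < q
ι-cancel-< {p} {q} ιp<ιq = ≰⇒> λ q≤p → ℚ.<-irrefl refl (ℚ.<-≤-trans ιp<ιq (ι-mono-≤ q≤p))

*-mono-≤-nonNeg : ∀ {p q r s} → 0ℚ ℚ.≤ r → 0ℚ ℚ.≤ q → p ℚ.≤ q → r ℚ.≤ s → p ℚ.* r ℚ.≤ q ℚ.* s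
*-mono-≤-nonNeg {q = q} {r} 0≤r 0≤q p≤q r≤s = ℚ.≤-trans
  (ℚ.*-monoʳ-≤-nonNeg r {{ℚ.nonNegative 0≤r}} p≤q)
  (ℚ.*-monoˡ-≤-nonNeg q {{ℚ.nonNegative 0≤q}} r≤s)

sq-mono-< : ∀ {p q} → 0ℚ ℚ.≤ p → p ℚ.< q → p ℚ.* p ℚ.< q ℚ.* q
sq-mono-< {p} {q} 0≤p p<q = ℚ.≤-<-trans
  (ℚ.*-monoˡ-≤-nonNeg p {{ℚ.nonNegative 0≤p}} (ℚ.<⇒≤ p<q))
  (ℚ.*-monoˡ-<-pos q {{ℚ.positive (ℚ.≤-<-trans 0≤p p<q)}} p<q)

module _ (x : ℝ) where
  open ℝ x

  √-ceiling-upper : ∀ k → IsCeiling (√ x) k → ¬ lower (ι (k * k))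
  √-ceiling-upper k (_ , √x≤k) k²<x =
    ℚ.<-irrefl refl (√x≤k (ι k) (inj₂ (subst lower (ι-* k k) k²<x)))

  √-ceiling-lower : ∀ j → IsCeiling (√ x) (suc j) → lower (ι (j * j))
  √-ceiling-lower j ((q , j<q , inj₁ q<0) , _) =
    ⊥-elim (ℚ.<-asym q<0 (ℚ.≤-<-trans (0≤ι j) j<q))
  √-ceiling-lower j ((q , j<q , inj₂ q²<x) , _) =
    lower-down (subst (ℚ._< q ℚ.* q) (sym (ι-* j j)) (sq-mono-< (0≤ι j) j<q)) q²<x

n≤⌈√n⌉² : ∀ n s → IsCeiling (√ ofℕ n) s → n ≤ s * s
n≤⌈√n⌉² n s s↑ = ≮⇒≥ λ s²<n → √-ceiling-upper (ofℕ n) s s↑ (ι-mono-< s²<n)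

-- For s = j + 1 the ceiling gives j² < n, hence j² + 1 ≤ n in integers, and (j + 1)² ≤ 2 (j² + 1).
⌈√n⌉²≤2n : ∀ n s → IsCeiling (√ ofℕ n) s → s * s ≤ 2 * n
⌈√n⌉²≤2n n zero    _  = z≤n
⌈√n⌉²≤2n n (suc j) s↑ = begin
  suc j * suc j               ≡⟨ eq₁ j ⟩
  2 * (j * 1) + (j * j + 1)   ≤⟨ +-monoˡ-≤ _ (2ab≤a²+b² j 1) ⟩
  j * j + 1 + (j * j + 1)     ≡⟨ eq₂ (j * j) ⟩
  2 * suc (j * j)             ≤⟨ *-monoʳ-≤ 2 (ι-cancel-< {j * j} {n} (√-ceiling-lower (ofℕ n) j s↑)) ⟩
  2 * n                       ∎
  where
  open ≤-Reasoning
  eq₁ : ∀ j → (1 + j) * (1 + j) ≡ 2 * (j * 1) + (j * j + 1)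
  eq₁ = solve-∀
  eq₂ : ∀ p → p + 1 + (p + 1) ≡ 2 * (1 + p)
  eq₂ = solve-∀

module _ (n : ℕ) .{{_ : NonZero n}} where

  n≤2^⌈√log₂n⌉² : ∀ k → IsCeiling (√ log₂ n) k → n ≤ 2 ^ (k * k)
  n≤2^⌈√log₂n⌉² k k↑ = ≮⇒≥ λ lt → √-ceiling-upper (log₂ n) k k↑
    (subst (log₂-lower n) (sym (ι≡mkℚ (k * k))) (subst (2 ^ (k * k) <_) (sym (^-identityʳ n)) lt))

  2^[⌈√log₂n⌉-1]²<n : ∀ j → IsCeiling (√ log₂ n) (suc j) → 2 ^ (j * j) < n
  2^[⌈√log₂n⌉-1]²<n j k↑ = subst (2 ^ (j * j) <_) (^-identityʳ n)
    (subst (log₂-lower n) (ι≡mkℚ (j * j)) (√-ceiling-lower (log₂ n) j k↑))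

  -- The lower cut of `reciprocal` asks for a rational strictly above the logarithm. Since the
  -- logarithm may equal k², the next square is taken.
  log₂<[1+⌈√log₂n⌉]² : ∀ k → IsCeiling (√ log₂ n) k → log₂-upper n (ι (suc k * suc k))
  log₂<[1+⌈√log₂n⌉]² k k↑ = subst (log₂-upper n) (sym (ι≡mkℚ (suc k * suc k)))
    (subst (_< 2 ^ (suc k * suc k)) (sym (^-identityʳ n))
      (≤-<-trans (n≤2^⌈√log₂n⌉² k k↑)
        (^-monoʳ-< 2 (s≤s (s≤s z≤n)) (*-mono-< (n<1+n k) (n<1+n k)))))

/-*-≤ : ∀ S D K c .{{_ : NonZero D}} → K * S ≤ c * D → (ℤ.+ S ℚ./ D) ℚ.* ι K ℚ.≤ ι c
/-*-≤ S D@(suc d) K c le = ℚ.toℚᵘ-cancel-≤ (begin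
  ℚ.toℚᵘ ((ℤ.+ S ℚ./ D) ℚ.* ι K)
    ≃⟨ ℚ.toℚᵘ-homo-* (ℤ.+ S ℚ./ D) (ι K) ⟩
  ℚ.toℚᵘ (ℤ.+ S ℚ./ D) ℚᵘ.* ℚ.toℚᵘ (ι K)
    ≃⟨ ℚᵘ.*-cong (ℚ.toℚᵘ-fromℚᵘ (mkℚᵘ (ℤ.+ S) d)) (ℚ.toℚᵘ-fromℚᵘ (mkℚᵘ (ℤ.+ K) 0)) ⟩
  mkℚᵘ (ℤ.+ S) d ℚᵘ.* mkℚᵘ (ℤ.+ K) 0
    ≤⟨ ℚᵘ.*≤* cross ⟩
  mkℚᵘ (ℤ.+ c) 0
    ≃⟨ ℚ.toℚᵘ-fromℚᵘ (mkℚᵘ (ℤ.+ c) 0) ⟨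
  ℚ.toℚᵘ (ι c)
    ∎)
  where
  open ℚᵘ.≤-Reasoning
  cross : (ℤ.+ S ℤ.* ℤ.+ K) ℤ.* ℤ.+ 1 ℤ.≤ ℤ.+ c ℤ.* ℤ.+ (D * 1)
  cross = subst₂ ℤ._≤_
    (trans (ℤ.pos-* S K) (sym (ℤ.*-identityʳ (ℤ.+ S ℤ.* ℤ.+ K))))
    (ℤ.pos-* c (D * 1))
    (ℤ.+≤+ (subst₂ _≤_ (*-comm K S) (cong (c *_) (sym (*-identityʳ D))) le))

∑∣image-alternating∣-ceilings : ∀ n .{{_ : NonZero n}} s k →
  IsCeiling (√ ofℕ n) s → IsCeiling (√ log₂ n) k →
  suc k * sum (λ i → ∣ image (δ⟨ alternating s k ⟩ (automaton {n} i)) ⊤ ∣) ≤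
  4384 * s * n ^ (n * 2)
∑∣image-alternating∣-ceilings n s k s↑ k↑ = *-cancelˡ-≤ (suc s) (begin
  suc s * (suc k * sum (λ i → ∣ image (δ⟨ alternating s k ⟩ (automaton {n} i)) ⊤ ∣))
    ≤⟨ ∑∣image-alternating∣ n s k ⟩
  (64 * (64 * n + 2 * (suc s * suc s)) + 2 * (suc k * suc k) * suc s) * n ^ (n * 2)
    -- Every summand becomes a constant times `suc s * s`, so that `suc s` cancels: n ≤ s², 1 + s ≤
    -- s + s and (k + 1)² ≤ 16 s. The constants add up to 64 · 64 + 64 · 4 + 2 · 16 = 4384.
    ≤⟨ *-monoˡ-≤ (n ^ (n * 2)) (+-mono-≤
         (*-monoʳ-≤ 64 (+-mono-≤
           (*-monoʳ-≤ 64 (≤-trans n≤s² (*-monoˡ-≤ s (n≤1+n s))))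
           (*-monoʳ-≤ 2 (*-monoʳ-≤ (suc s) (+-monoˡ-≤ s 1≤s)))))
         (*-monoˡ-≤ (suc s) (*-monoʳ-≤ 2 ([1+k]²≤16s k s 1≤s λ j eq →
           ≤-trans (<⇒≤ (2^[⌈√log₂n⌉-1]²<n n j (subst (IsCeiling (√ log₂ n)) eq k↑))) n≤s²)))) ⟩
  (64 * (64 * (suc s * s) + 2 * (suc s * (s + s))) + 2 * (16 * s) * suc s) * n ^ (n * 2)
    ≡⟨ eq 64 16 s (n ^ (n * 2)) ⟩
  suc s * (4384 * s * n ^ (n * 2))
    ∎)
  where
  open ≤-Reasoning
  n≤s² : n ≤ s * s
  n≤s² = n≤⌈√n⌉² n s s↑
  1≤s : 1 ≤ s
  1≤s = positive s (≤-trans (>-nonZero⁻¹ n) n≤s²)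
    where
    positive : ∀ s → 1 ≤ s * s → 1 ≤ s
    positive (suc s) _ = s≤s z≤n
  eq : ∀ p q s D → (p * (p * ((1 + s) * s) + 2 * ((1 + s) * (s + s))) + 2 * (q * s) * (1 + s)) * D ≡
       (1 + s) * ((p * p + p * 4 + 2 * q) * s * D)
  eq = solve-∀

-- From the bound on the expectation to the big-O statement.

𝔼∣A∣-bound : ∀ n .{{_ : NonTrivial n}} →
  𝔼∣A∣ n ℚ.* ι (suc (⌈√log₂ n ⌉ {{nonTrivial⇒nonZero n}})) ℚ.≤ ι (4384 * ⌈√ n ⌉)
𝔼∣A∣-bound n = /-*-≤ (sum (λ i → ∣ A {n} (automaton i) ∣)) (n ^ (n * 2))
  (suc ⌈√log₂ n ⌉) (4384 * ⌈√ n ⌉) {{m^n≢0 n (n * 2)}}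
  (∑∣image-alternating∣-ceilings n ⌈√ n ⌉ ⌈√log₂ n ⌉ (⌈√⌉-isCeiling n) (⌈√log₂⌉-isCeiling n))
  where
  instance
    n≢0 : NonZero n
    n≢0 = nonTrivial⇒nonZero n

-- Here `u` is 1 / n. The hypotheses give x C K ≤ c, and squaring yields x² C² K² < C² n. The
-- conclusion is what places x² / n in the lower cut of the reciprocal of the logarithm when K² lies
-- above the logarithm.
ratio-bound : ∀ C n K c {x u E : ℚ} → ι n ℚ.* u ≡ 1ℚ → c * c < C * C * n →
  0ℚ ℚ.≤ x → x ℚ.* ι C ℚ.< E → E ℚ.* ι K ℚ.≤ ι c → x ℚ.* x ℚ.* u ℚ.* ι (K * K) ℚ.< 1ℚ
ratio-bound C n K c {x} {u} {E} nu≡1 c²<C²n 0≤x xC<E EK≤c =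
  ℚ.*-cancelˡ-<-nonNeg (ι (C * C * n)) {{ℚ.nonNegative (0≤ι (C * C * n))}} (begin-strict
    ι (C * C * n) ℚ.* (x ℚ.* x ℚ.* u ℚ.* ι (K * K))
      ≡⟨ cong₂ ℚ._*_ (trans (ι-* (C * C) n) (cong (ℚ._* ι n) (ι-* C C)))
                     (cong (x ℚ.* x ℚ.* u ℚ.*_) (ι-* K K)) ⟩
    ι C ℚ.* ι C ℚ.* ι n ℚ.* (x ℚ.* x ℚ.* u ℚ.* (ι K ℚ.* ι K))
      ≡⟨ solve 5 (λ C n x u K → C :* C :* n :* (x :* x :* u :* (K :* K)) :=
                                n :* u :* (x :* C :* K :* (x :* C :* K))) refl (ι C) (ι n) x u (ι K) ⟩
    ι n ℚ.* u ℚ.* (y ℚ.* y)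
      ≡⟨ trans (cong (ℚ._* (y ℚ.* y)) nu≡1) (ℚ.*-identityˡ (y ℚ.* y)) ⟩
    y ℚ.* y
      ≤⟨ *-mono-≤-nonNeg 0≤y (0≤ι c) y≤c y≤c ⟩
    ι c ℚ.* ι c
      ≡⟨ ι-* c c ⟨
    ι (c * c)
      <⟨ ι-mono-< c²<C²n ⟩
    ι (C * C * n)
      ≡⟨ ℚ.*-identityʳ (ι (C * C * n)) ⟨
    ι (C * C * n) ℚ.* 1ℚ
      ∎)
  where
  open ℚ.≤-Reasoning
  y : ℚ
  y = x ℚ.* ι C ℚ.* ι K
  0≤* : ∀ {p} q → 0ℚ ℚ.≤ p → 0ℚ ℚ.≤ p ℚ.* ι q
  0≤* {p} q 0≤p = subst (ℚ._≤ p ℚ.* ι q) (ℚ.*-zeroˡ (ι q))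
    (ℚ.*-monoʳ-≤-nonNeg (ι q) {{ℚ.nonNegative (0≤ι q)}} 0≤p)
  0≤y : 0ℚ ℚ.≤ y
  0≤y = 0≤* K (0≤* C 0≤x)
  y≤c : y ℚ.≤ ι c
  y≤c = ℚ.≤-trans (ℚ.*-monoʳ-≤-nonNeg (ι K) {{ℚ.nonNegative (0≤ι K)}} (ℚ.<⇒≤ xC<E)) EK≤c

-- The number 8000 is a round value above 4384 √2, where √2 comes from s² ≤ 2 n.
[4384s]²<8000²n : ∀ n .{{_ : NonZero n}} s → s * s ≤ 2 * n →
  4384 * s * (4384 * s) < 8000 * 8000 * n
[4384s]²<8000²n n s s²≤2n = begin-strict
  4384 * s * (4384 * s)       ≡⟨ square-* 4384 s ⟩
  4384 * 4384 * (s * s)       ≤⟨ *-monoʳ-≤ (4384 * 4384) s²≤2n ⟩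
  4384 * 4384 * (2 * n)       ≡⟨ *-assoc (4384 * 4384) 2 n ⟨
  4384 * 4384 * 2 * n         <⟨ *-monoˡ-< n (<ᵇ⇒< (4384 * 4384 * 2) (8000 * 8000) tt) ⟩
  8000 * 8000 * n             ∎
  where
  open ≤-Reasoning
  square-* : ∀ c s → c * s * (c * s) ≡ c * c * (s * s)
  square-* = solve-∀

<⇒lower-•√ : ∀ C .{{_ : Positive (ι C)}} n .{{_ : NonTrivial n}} K c {E} →
  log₂-upper n (ι (K * K)) → c * c < C * C * n → E ℚ.* ι K ℚ.≤ ι c →
  ∀ q → q ℚ.< E → ℝ.lower (ι C • √ (n/log₂ n)) q
<⇒lower-•√ C n K c {E} log₂n<K² c²<C²n EK≤c q q<E with (q ℚ.÷ ι C) {{ℚ.pos⇒nonZero (ι C)}} ℚ.<? 0ℚ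
... | yes x<0 = inj₁ x<0
-- For nonnegative q / C membership in the cut of the root means that (q / C)² / n lies in the lower
-- cut of `reciprocal`; K² is the rational witness above the logarithm.
... | no  x≮0 = inj₂ (ι (K * K) , log₂n<K² ,
    ratio-bound C n K c (ℚ.*-inverseʳ (ι n)) c²<C²n (ℚ.≮⇒≥ x≮0)
      (subst (ℚ._< E) (sym q÷C*C) q<E) EK≤c)
  where
  instance
    ιn≢0 : ℚ.NonZero (ι n)
    ιn≢0 = ℚ.pos⇒nonZero (ι n) {{ℚ.normalize-pos n 1 {{_}} {{nonTrivial⇒nonZero n}}}}
    ιC≢0 : ℚ.NonZero (ι C)
    ιC≢0 = ℚ.pos⇒nonZero (ι C)
  q÷C*C : q ℚ.÷ ι C ℚ.* ι C ≡ q
  q÷C*C = trans (ℚ.*-assoc q (ℚ.1/ ι C) (ι C))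
    (trans (cong (q ℚ.*_) (ℚ.*-inverseˡ (ι C))) (ℚ.*-identityʳ q))

theorem1p2 : (λ n → ofℚ (𝔼∣A∣ n)) =O (λ n → √ (n/log₂ n))
-- The threshold is 0 because the bound holds for every n ≥ 2.
theorem1p2 = ι 8000 , ι8000>0 , 0 , λ n _ → <⇒lower-•√ 8000 {{ι8000>0}} n
    (suc (⌈√log₂ n ⌉ {{nonTrivial⇒nonZero n}})) (4384 * ⌈√ n ⌉)
    (log₂<[1+⌈√log₂n⌉]² n {{nonTrivial⇒nonZero n}} (⌈√log₂ n ⌉ {{nonTrivial⇒nonZero n}})
      (⌈√log₂⌉-isCeiling n {{nonTrivial⇒nonZero n}}))
    ([4384s]²<8000²n n {{nonTrivial⇒nonZero n}} ⌈√ n ⌉ (⌈√n⌉²≤2n n ⌈√ n ⌉ (⌈√⌉-isCeiling n)))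
    (𝔼∣A∣-bound n)
  where
  ι8000>0 : Positive (ι 8000)
  ι8000>0 = ℚ.normalize-pos 8000 1
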